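{- Let $N$ and $k$ be positive integers. Then, as formal power series in $q$, $$\sum_{n=1}^{\infty}\big(\mu_{2k,N}(n)-\eta_{2k,N}(n)\big)q^n=\frac{1}{(q)_N}\sum_{N\ge n_k\ge\cdots\ge n_1\ge1}\frac{(q)_{n_1}\,q^{n_1+n_2+\cdots+n_k}}{(1-q^{n_1})^2(1-q^{n_2})^2\cdots(1-q^{n_k})^2},$$ where $\eta_{2k,N}(n):=\sum_{m=-n}^{n}\binom{m+k-1}{2k}N_{S_1}(m,n)$ and $\mu_{2k,N}(n):=\sum_{m=-n}^{n}\binom{m+k-1}{2k}M_{S_2}(m,n)$.
   Context: $(a)_n=(a;q)_n=\prod_{i=0}^{n-1}(1-aq^i)$, $(a)_0=1$; $\binom{x}{k}=\frac{x(x-1)\cdots(x-k+1)}{k!}$ for any integer $x$. For a partition $\pi$, $|\pi|$ is the sum of its parts, $\#(\pi)$ its number of parts, and $l(\pi)$ its largest part ($0$ if empty); the rank of a nonempty partition is its largest part minus its number of parts. A partition has Durfee square of size $j$ if $j$ is the largest integer such that it has at least $j$ parts that are $\ge j$. For $1\le j\le N$, let $S_1^{(j)}$ be the set of pairs $\vec\pi=(\pi_1,\pi_2)$ where $\pi_1$ is a (possibly empty) partition into distinct parts, all lying in $[N-j+1,N]$, and $\pi_2$ is a partition with Durfee square of size $j$; set $|\vec\pi|=|\pi_1|+|\pi_2|$, $w_r(\vec\pi)=(-1)^{\#(\pi_1)}$, $\mathrm{rank}(\vec\pi)=\mathrm{rank}(\pi_2)$, and $N_{S_1}(m,n)=\sum_{j=1}^{N}\sum_{\vec\pi\in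 S_1^{(j)},\ |\vec\pi|=n,\ \mathrm{rank}(\vec\pi)=m} w_r(\vec\pi)$. Let $S_2$ be the set of triples $\vec\pi=(\pi_1,\pi_2,\pi_3)$ where $\pi_1$ is a partition into distinct parts and $\pi_2,\pi_3$ are partitions (all possibly empty), with $l(\pi_1),l(\pi_2),l(\pi_3)\le N$; set $|\vec\pi|=|\pi_1|+|\pi_2|+|\pi_3|$, $w_c(\vec\pi)=(-1)^{\#(\pi_1)}$, $\mathrm{crank}(\vec\pi)=\#(\pi_2)-\#(\pi_3)$, and $M_{S_2}(m,n)=\sum_{\vec\pi\in S_2,\ |\vec\pi|=n,\ \mathrm{crank}(\vec\pi)=m} w_c(\vec\pi)$. -}

module Defs where

open import Data.Bool using (Bool; true; false; if_then_else_)
open import Data.Nat as ℕ using (ℕ; zero; suc; _∸_; _!)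
open import Data.Nat.Properties using (_!≢0)
open import Data.Nat.Divisibility using (_∣?_)
open import Data.Integer as ℤ using (ℤ; +_; 0ℤ; 1ℤ; -_; _/ℕ_)
open import Data.List using (List; []; _∷_; map; concatMap; upTo; length; filter; foldr; replicate; _++_; reverse)
open import Data.Nat.ListAction using (sum)
open import Relation.Nullary.Decidable using (⌊_⌋; _×-dec_)
open import Relation.Binary.PropositionalEquality using (_≡_)

Σℤ : List ℤ → ℤ
Σℤ = foldr ℤ._+_ 0ℤ

range : ℕ → ℕ → List ℕ
range lo hi = map (lo ℕ.+_) (upTo (suc hi ∸ lo))

symRange : ℕ → List ℤ
symRange n = map (λ i → (+ i) ℤ.- (+ n)) (upTo (suc (2 ℕ.* n)))

falling : ℤ → ℕ → ℤ
falling x zero    = 1ℤ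
falling x (suc k) = x ℤ.* falling (x ℤ.- 1ℤ) k

binom : ℤ → ℕ → ℤ
binom x k = _/ℕ_ (falling x k) (k !) {{k !≢0}}

-- Partitions: represented as nonincreasing lists of positive naturals.

partsLE : ℕ → ℕ → List (List ℕ)
partsLE zero n = if ⌊ n ℕ.≟ 0 ⌋ then ([] ∷ []) else []
partsLE (suc b) n =
  concatMap (λ t → map (replicate t (suc b) ++_) (partsLE b (n ∸ t ℕ.* suc b)))
            (filter (λ t → t ℕ.* suc b ℕ.≤? n) (upTo (suc n)))

-- all partitions of n into distinct parts taken from the list `allowed`
-- (allowed given in decreasing order, without repetitions)
distinctIn : List ℕ → ℕ → List (List ℕ)
distinctIn [] n = if ⌊ n ℕ.≟ 0 ⌋ then ([] ∷ []) else []
distinctIn (a ∷ as) n =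
  distinctIn as n ++
  (if ⌊ a ℕ.≤? n ⌋ then map (a ∷_) (distinctIn as (n ∸ a)) else [])

partitions : ℕ → List (List ℕ)
partitions n = partsLE n n

decRange : ℕ → ℕ → List ℕ
decRange lo hi = reverse (range lo hi)

#_ : List ℕ → ℕ
# π = length π

largest : List ℕ → ℕ
largest = foldr ℕ._⊔_ 0

countGE : ℕ → List ℕ → ℕ
countGE j π = length (filter (λ x → j ℕ.≤? x) π)

durfee : List ℕ → ℕ
durfee π = largest (filter (λ j → j ℕ.≤? countGE j π) (upTo (suc (length π))))

rank : List ℕ → ℤ
rank π = (+ largest π) ℤ.- (+ # π)

sign : List ℕ → ℤ
sign π = foldr (λ _ s → - s) 1ℤ π

NS1 : ℕ → ℤ → ℕ → ℤ
NS1 N m n =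
  Σℤ (map (λ j →
    Σℤ (map (λ a →
      Σℤ (map (λ π1 →
        Σℤ (map (λ π2 →
              if ⌊ (durfee π2 ℕ.≟ j) ×-dec (rank π2 ℤ.≟ m) ⌋ then sign π1 else 0ℤ)
            (partitions (n ∸ a))))
        (distinctIn (decRange (suc N ∸ j) N) a)))
      (upTo (suc n))))
    (range 1 N))

crank : List ℕ → List ℕ → ℤ
crank π2 π3 = (+ # π2) ℤ.- (+ # π3)

MS2 : ℕ → ℤ → ℕ → ℤ
MS2 N m n =
  Σℤ (map (λ a →
    Σℤ (map (λ b →
      Σℤ (map (λ π1 →
        Σℤ (map (λ π2 →
          Σℤ (map (λ π3 →
                if ⌊ crank π2 π3 ℤ.≟ m ⌋ then sign π1 else 0ℤ)
              (partsLE N (n ∸ a ∸ b))))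
          (partsLE N b)))
        (distinctIn (decRange 1 N) a)))
      (upTo (suc (n ∸ a)))))
    (upTo (suc n)))

η : ℕ → ℕ → ℕ → ℤ
η k N n = Σℤ (map (λ m → binom (m ℤ.+ (+ k) ℤ.- 1ℤ) (2 ℕ.* k) ℤ.* NS1 N m n) (symRange n))

μ : ℕ → ℕ → ℕ → ℤ
μ k N n = Σℤ (map (λ m → binom (m ℤ.+ (+ k) ℤ.- 1ℤ) (2 ℕ.* k) ℤ.* MS2 N m n) (symRange n))

-- Formal power series over ℤ in q, as coefficient sequences.

Series : Set
Series = ℕ → ℤ

zeroS : Series
zeroS _ = 0ℤ

oneS : Series
oneS zero    = 1ℤ
oneS (suc _) = 0ℤ

_+S_ : Series → Series → Series
(f +S g) n = f n ℤ.+ g n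

_*S_ : Series → Series → Series
(f *S g) n = Σℤ (map (λ i → f i ℤ.* g (n ∸ i)) (upTo (suc n)))

qPow : ℕ → Series
qPow a n = if ⌊ n ℕ.≟ a ⌋ then 1ℤ else 0ℤ

oneMinusQ : ℕ → Series
oneMinusQ a n = oneS n ℤ.- qPow a n

-- 1/(1 - q^a) for a ≥ 1 : the geometric series Σ_{t ≥ 0} q^{a t}
invOneMinusQ : ℕ → Series
invOneMinusQ a n = if ⌊ a ∣? n ⌋ then 1ℤ else 0ℤ

prodS : List Series → Series
prodS = foldr _*S_ oneS

sumS : List Series → Series
sumS = foldr _+S_ zeroS

poch : ℕ → Series
poch n = prodS (map oneMinusQ (range 1 n))

invPoch : ℕ → Series
invPoch N = prodS (map invOneMinusQ (range 1 N))

chains : ℕ → ℕ → ℕ → List (List ℕ)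
chains N zero    lo = [] ∷ []
chains N (suc k) lo = concatMap (λ v → map (v ∷_) (chains N k v)) (range lo N)

summand : List ℕ → Series
summand [] = zeroS
summand (n₁ ∷ ns) =
  poch n₁ *S (qPow (sum (n₁ ∷ ns)) *S
    prodS (map (λ ni → invOneMinusQ ni *S invOneMinusQ ni) (n₁ ∷ ns)))

rhs : ℕ → ℕ → Series
rhs k N = invPoch N *S sumS (map summand (chains N k 1))

lhs : ℕ → ℕ → Series
lhs k N zero    = 0ℤ
lhs k N (suc n) = μ k N (suc n) ℤ.- η k N (suc n)

{-# OPTIONS --safe #-}

-- Write y = z + 1/z − 2 and D_i = (1 − z q^i)(1 − q^i/z) = (1 − q^i)² − q^i y. The second difference of
-- the weight b_k(m) = binom (m + k − 1) (2k) is b_(k−1), so taking b_k-moments in z turns multiplication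
-- by y into the shift k ↦ k + 1: moments are coefficients of powers of y.
-- The crank series C_N = (q)_N / (D_1 ⋯ D_N) satisfies D_N C_N = (1 − q^N) C_(N−1). By Durfee squares the
-- rank series is R_N = Σ_j (1 − q^(N−j+1)) ⋯ (1 − q^N) q^(j²) / (D_1 ⋯ D_j), and since
-- D_N − 1 + q^(N−j) = q^(N−j) D_j − q^(N+j) (1 − q^(N−j)), the sum D_N R_N − (1 − q^N) R_(N−1) telescopes
-- to − q^N y. Hence X_N = C_N − R_N satisfies D_N X_N = (1 − q^N) X_(N−1) + q^N y. So does the right-hand
-- side, by the recursion of complete homogeneous symmetric polynomials in q^i/(1 − q^i)², and D_N is
-- invertible.

module Submission where

open import Defs
open import Algebra.Bundles using (CommutativeRing)
open import Algebra.Solver.Ring.AlmostCommutativeRing using (AlmostCommutativeRing; fromCommutativeRing; _-Raw-AlmostCommutative⟶_)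
import Algebra.Solver.Ring
open import Data.Bool using (if_then_else_)
open import Data.Integer as ℤ using (ℤ; +_; -[1+_]; 0ℤ; 1ℤ; _/ℕ_)
import Data.Integer.Properties as ℤ
open import Data.Integer.Tactic.RingSolver using (solve-∀)
open import Data.List using (List; []; _∷_; map; upTo; downFrom; filter; concatMap; replicate; reverse; length; _++_)
open import Data.List.Properties using (map-upTo; map-applyUpTo; upTo-∷ʳ; map-++; filter-accept; filter-reject; filter-none; length-filter; reverse-map; reverse-upTo)
open import Data.List.Membership.Propositional using (_∈_)
open import Data.List.Membership.Propositional.Properties using (∈-upTo⁺; ∈-upTo⁻; ∈-filter⁺)
open import Data.List.Relation.Unary.All as All using (All; []; _∷_)
import Data.List.Relation.Unary.All.Properties as All
open import Data.List.Relation.Unary.Any using (here; there)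
open import Data.Maybe using (Maybe; just; nothing)
open import Data.Nat using (ℕ; zero; suc; _∸_; _⊔_; _≤_; _<_; z≤n; s≤s; _≤?_; _≟_; _!; NonZero)
import Data.Nat as ℕ
import Data.Nat.DivMod as ℕ
import Data.Nat.Properties as ℕ
open import Data.Nat.Divisibility using (_∣?_; ∣m+n∣m⇒∣n; ∣m∣n⇒∣m+n; ∣-refl; _∣0; ∣⇒≤)
open import Data.Nat.ListAction using (sum)
open import Data.Nat.ListAction.Properties using (sum-++)
open import Data.Nat.Tactic.RingSolver using () renaming (solve-∀ to solveℕ-∀)
open import Data.Product using (∃; _×_; _,_; proj₁; proj₂)
open import Data.Sum using (inj₁; inj₂)
open import Function using (_∘_; flip)
open import Level using (0ℓ)
open import Relation.Nullary using (Dec; yes; no; ¬_; contradiction)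
open import Relation.Nullary.Decidable using (⌊_⌋; _×-dec_)
open import Relation.Binary.PropositionalEquality using (_≡_; refl; sym; trans; cong; cong₂; subst; module ≡-Reasoning)
import Relation.Binary.Reasoning.Setoid

-- The variable z never appears. A series in z and q is known only through its pairings with weights
-- `f : ℤ → ℤ` on the exponent of z, as in `crankSum`; translating `f` plays the part of multiplying
-- by a power of z, so every identity about D_i becomes one about second differences of `f`. The
-- weights b_k are closed under these only together with the constant weight b_0 = 1, so all
-- recursions are stated for every k ≥ 0 although the theorem starts at k = 1. The Durfee
-- decomposition meets an obstacle: partitions are enumerated by removing their largest part,
-- whereas the rank needs the piece to the right of the square read by columns. No conjugation map
-- is built. Generating functions of finite boxes are shown to satisfy the recursion by columns as
-- well as the one by rows, and a box at least as wide as the degree in question behaves like an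
-- unbounded one.

private
  variable
    A B : Set

-- Finite sums

∑ : List A → (A → ℤ) → ℤ
∑ xs f = Σℤ (map f xs)

∑-cong : ∀ (xs : List A) {f g : A → ℤ} → (∀ x → f x ≡ g x) → ∑ xs f ≡ ∑ xs g
∑-cong []       e = refl
∑-cong (x ∷ xs) e = cong₂ ℤ._+_ (e x) (∑-cong xs e)

∑-++ : ∀ (xs ys : List A) (f : A → ℤ) → ∑ (xs ++ ys) f ≡ ∑ xs f ℤ.+ ∑ ys f
∑-++ []       ys f = sym (ℤ.+-identityˡ _)
∑-++ (x ∷ xs) ys f = trans (cong (λ s → f x ℤ.+ s) (∑-++ xs ys f)) (sym (ℤ.+-assoc (f x) (∑ xs f) (∑ ys f)))

∑-map : ∀ (h : B → A) (xs : List B) (f : A → ℤ) → ∑ (map h xs) f ≡ ∑ xs (f ∘ h)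
∑-map h []       f = refl
∑-map h (x ∷ xs) f = cong (λ s → f (h x) ℤ.+ s) (∑-map h xs f)

+-interchange : ∀ a b c d → (a ℤ.+ b) ℤ.+ (c ℤ.+ d) ≡ (a ℤ.+ c) ℤ.+ (b ℤ.+ d)
+-interchange = solve-∀

∑-+ : ∀ (xs : List A) (f g : A → ℤ) → ∑ xs (λ x → f x ℤ.+ g x) ≡ ∑ xs f ℤ.+ ∑ xs g
∑-+ []       f g = refl
∑-+ (x ∷ xs) f g = trans (cong (λ s → f x ℤ.+ g x ℤ.+ s) (∑-+ xs f g)) (+-interchange (f x) (g x) (∑ xs f) (∑ xs g))

∑-zero : ∀ (xs : List A) → ∑ xs (λ _ → 0ℤ) ≡ 0ℤ
∑-zero []       = refl
∑-zero (x ∷ xs) = trans (ℤ.+-identityˡ _) (∑-zero xs)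

∑-*ˡ : ∀ (xs : List A) c (f : A → ℤ) → ∑ xs (λ x → c ℤ.* f x) ≡ c ℤ.* ∑ xs f
∑-*ˡ []       c f = sym (ℤ.*-zeroʳ c)
∑-*ˡ (x ∷ xs) c f = trans (cong (λ s → c ℤ.* f x ℤ.+ s) (∑-*ˡ xs c f)) (sym (ℤ.*-distribˡ-+ c (f x) (∑ xs f)))

∑-*ʳ : ∀ (xs : List A) (f : A → ℤ) c → ∑ xs (λ x → f x ℤ.* c) ≡ ∑ xs f ℤ.* c
∑-*ʳ []       f c = refl
∑-*ʳ (x ∷ xs) f c = trans (cong (λ s → f x ℤ.* c ℤ.+ s) (∑-*ʳ xs f c)) (sym (ℤ.*-distribʳ-+ c (f x) (∑ xs f)))

∑-swap : ∀ (xs : List A) (ys : List B) (f : A → B → ℤ) → ∑ xs (λ x → ∑ ys (f x)) ≡ ∑ ys (λ y → ∑ xs (λ x → f x y))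
∑-swap []       ys f = sym (∑-zero ys)
∑-swap (x ∷ xs) ys f = trans (cong (λ s → ∑ ys (f x) ℤ.+ s) (∑-swap xs ys f)) (sym (∑-+ ys (f x) (λ y → ∑ xs (λ z → f z y))))

∑-upTo-suc : ∀ (f : ℕ → ℤ) n → ∑ (upTo (suc n)) f ≡ f 0 ℤ.+ ∑ (upTo n) (f ∘ suc)
∑-upTo-suc f n = cong (λ s → f 0 ℤ.+ s) (cong Σℤ (trans (map-applyUpTo suc f n) (sym (map-upTo (f ∘ suc) n))))

-- Sums over i + j = n

conv : (ℕ → ℕ → ℤ) → ℕ → ℤ
conv h zero    = h 0 0
conv h (suc n) = h 0 (suc n) ℤ.+ conv (h ∘ suc) n

-- Trades the truncated subtraction in `_*S_` for structural recursion; commutativity and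
-- associativity of the product are proved on `conv`.
∑-conv : ∀ (h : ℕ → ℕ → ℤ) n → ∑ (upTo (suc n)) (λ i → h i (n ∸ i)) ≡ conv h n
∑-conv h zero    = ℤ.+-identityʳ _
∑-conv h (suc n) = trans (∑-upTo-suc (λ i → h i (suc n ∸ i)) (suc n)) (cong (λ s → h 0 (suc n) ℤ.+ s) (∑-conv (h ∘ suc) n))

conv-cong : ∀ {h k : ℕ → ℕ → ℤ} → (∀ i j → h i j ≡ k i j) → ∀ n → conv h n ≡ conv k n
conv-cong e zero    = e 0 0
conv-cong e (suc n) = cong₂ ℤ._+_ (e 0 (suc n)) (conv-cong (e ∘ suc) n)

conv-+ : ∀ (h k : ℕ → ℕ → ℤ) n → conv (λ i j → h i j ℤ.+ k i j) n ≡ conv h n ℤ.+ conv k n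
conv-+ h k zero    = refl
conv-+ h k (suc n) = trans (cong (λ s → h 0 (suc n) ℤ.+ k 0 (suc n) ℤ.+ s) (conv-+ (h ∘ suc) (k ∘ suc) n)) (+-interchange (h 0 (suc n)) (k 0 (suc n)) (conv (h ∘ suc) n) (conv (k ∘ suc) n))

conv-zero : ∀ n → conv (λ _ _ → 0ℤ) n ≡ 0ℤ
conv-zero zero    = refl
conv-zero (suc n) = trans (ℤ.+-identityˡ _) (conv-zero n)

conv-*ˡ : ∀ c (h : ℕ → ℕ → ℤ) n → conv (λ i j → c ℤ.* h i j) n ≡ c ℤ.* conv h n
conv-*ˡ c h zero    = refl
conv-*ˡ c h (suc n) = trans (cong (λ s → c ℤ.* h 0 (suc n) ℤ.+ s) (conv-*ˡ c (h ∘ suc) n)) (sym (ℤ.*-distribˡ-+ c (h 0 (suc n)) (conv (h ∘ suc) n)))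

conv-last : ∀ (h : ℕ → ℕ → ℤ) n → conv h (suc n) ≡ h (suc n) 0 ℤ.+ conv (λ i j → h i (suc j)) n
conv-last h zero    = ℤ.+-comm (h 0 1) (h 1 0)
conv-last h (suc n) = begin
  h 0 (2+ n) ℤ.+ conv (h ∘ suc) (suc n)
    ≡⟨ cong (λ s → h 0 (2+ n) ℤ.+ s) (conv-last (h ∘ suc) n) ⟩
  h 0 (2+ n) ℤ.+ (h (2+ n) 0 ℤ.+ conv (λ i j → h (suc i) (suc j)) n)
    ≡⟨ exchange (h 0 (2+ n)) (h (2+ n) 0) _ ⟩
  h (2+ n) 0 ℤ.+ (h 0 (2+ n) ℤ.+ conv (λ i j → h (suc i) (suc j)) n) ∎
  where
  open ≡-Reasoning
  2+ : ℕ → ℕ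
  2+ n = suc (suc n)
  exchange : ∀ a b c → a ℤ.+ (b ℤ.+ c) ≡ b ℤ.+ (a ℤ.+ c)
  exchange = solve-∀

conv-flip : ∀ (h : ℕ → ℕ → ℤ) n → conv h n ≡ conv (flip h) n
conv-flip h zero    = refl
conv-flip h (suc n) = trans (cong (λ s → h 0 (suc n) ℤ.+ s) (conv-flip (h ∘ suc) n)) (sym (conv-last (flip h) n))

-- Both sides sum `h a b c` over a + b + c = n. The induction splits off a = 0: on the left these
-- terms are the one with i = 0 together with the head of every inner sum, and they reassemble to
-- `conv (h 0) (suc n)`.
conv-assoc : ∀ (h : ℕ → ℕ → ℕ → ℤ) n →
  conv (λ i c → conv (λ a b → h a b c) i) n ≡ conv (λ a j → conv (h a) j) n
conv-assoc h zero    = refl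
conv-assoc h (suc n) = begin
  h 0 0 (suc n) ℤ.+ conv (λ i c → h 0 (suc i) c ℤ.+ conv (λ a b → h (suc a) b c) i) n
    ≡⟨ cong (λ s → h 0 0 (suc n) ℤ.+ s) (conv-+ (λ i c → h 0 (suc i) c) (λ i c → conv (λ a b → h (suc a) b c) i) n) ⟩
  h 0 0 (suc n) ℤ.+ (conv (λ i c → h 0 (suc i) c) n ℤ.+ conv (λ i c → conv (λ a b → h (suc a) b c) i) n)
    ≡⟨ sym (ℤ.+-assoc (h 0 0 (suc n)) _ _) ⟩
  conv (h 0) (suc n) ℤ.+ conv (λ i c → conv (λ a b → h (suc a) b c) i) n
    ≡⟨ cong (λ s → conv (h 0) (suc n) ℤ.+ s) (conv-assoc (h ∘ suc) n) ⟩
  conv (h 0) (suc n) ℤ.+ conv (λ a j → conv (h (suc a)) j) n ∎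
  where open ≡-Reasoning

-- The ring of power series

infix 4 _≈_

-- A record rather than a family of equations, so that both series can be read off from the type.
record _≈_ (f g : Series) : Set where
  constructor pointwise
  field
    at : ∀ n → f n ≡ g n

open _≈_ public

negS : Series → Series
negS f n = ℤ.- f n

const : ℤ → Series
const c zero    = c
const c (suc _) = 0ℤ

*S-conv : ∀ f g n → (f *S g) n ≡ conv (λ i j → f i ℤ.* g j) n
*S-conv f g = ∑-conv (λ i j → f i ℤ.* g j)

conv-const : ∀ c (g : ℕ → ℤ) n → conv (λ i j → const c i ℤ.* g j) n ≡ c ℤ.* g n
conv-const c g zero    = refl
conv-const c g (suc n) = trans (cong (λ s → c ℤ.* g (suc n) ℤ.+ s) (conv-zero n)) (ℤ.+-identityʳ _)

const-*S : ∀ c g n → (const c *S g) n ≡ c ℤ.* g n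
const-*S c g n = trans (*S-conv (const c) g n) (conv-const c g n)

oneS-const : ∀ n → oneS n ≡ const 1ℤ n
oneS-const zero    = refl
oneS-const (suc n) = refl

*S-cong : ∀ {f f′ g g′} → f ≈ f′ → g ≈ g′ → (f *S g) ≈ (f′ *S g′)
*S-cong p q = pointwise λ n → ∑-cong (upTo (suc n)) λ i → cong₂ ℤ._*_ (at p i) (at q (n ∸ i))

*S-comm : ∀ f g → (f *S g) ≈ (g *S f)
*S-comm f g = pointwise λ n → begin
  (f *S g) n                       ≡⟨ *S-conv f g n ⟩
  conv (λ i j → f i ℤ.* g j) n     ≡⟨ conv-flip (λ i j → f i ℤ.* g j) n ⟩
  conv (λ i j → f j ℤ.* g i) n     ≡⟨ conv-cong (λ i j → ℤ.*-comm (f j) (g i)) n ⟩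
  conv (λ i j → g i ℤ.* f j) n     ≡⟨ sym (*S-conv g f n) ⟩
  (g *S f) n                       ∎
  where open ≡-Reasoning

*S-assoc : ∀ f g h → ((f *S g) *S h) ≈ (f *S (g *S h))
*S-assoc f g h = pointwise λ n → begin
  ((f *S g) *S h) n
    ≡⟨ *S-conv (f *S g) h n ⟩
  conv (λ i c → (f *S g) i ℤ.* h c) n
    ≡⟨ conv-cong (λ i c → trans (cong (ℤ._* h c) (*S-conv f g i)) (trans (ℤ.*-comm _ (h c)) (sym (conv-*ˡ (h c) (λ a b → f a ℤ.* g b) i)))) n ⟩
  conv (λ i c → conv (λ a b → h c ℤ.* (f a ℤ.* g b)) i) n
    ≡⟨ conv-assoc (λ a b c → h c ℤ.* (f a ℤ.* g b)) n ⟩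
  conv (λ a j → conv (λ b c → h c ℤ.* (f a ℤ.* g b)) j) n
    ≡⟨ conv-cong (λ a j → trans (conv-cong (λ b c → rearrange (h c) (f a) (g b)) j) (conv-*ˡ (f a) (λ b c → g b ℤ.* h c) j)) n ⟩
  conv (λ a j → f a ℤ.* conv (λ b c → g b ℤ.* h c) j) n
    ≡⟨ conv-cong (λ a j → cong (f a ℤ.*_) (sym (*S-conv g h j))) n ⟩
  conv (λ a j → f a ℤ.* (g *S h) j) n
    ≡⟨ sym (*S-conv f (g *S h) n) ⟩
  (f *S (g *S h)) n ∎
  where
  open ≡-Reasoning
  rearrange : ∀ x y z → x ℤ.* (y ℤ.* z) ≡ y ℤ.* (z ℤ.* x)
  rearrange = solve-∀

*S-identityˡ : ∀ f → (oneS *S f) ≈ f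
*S-identityˡ f = pointwise λ n → trans (at (*S-cong {g = f} {g′ = f} (pointwise oneS-const) (pointwise λ _ → refl)) n) (trans (const-*S 1ℤ f n) (ℤ.*-identityˡ (f n)))

*S-distribˡ : ∀ f g h → (f *S (g +S h)) ≈ ((f *S g) +S (f *S h))
*S-distribˡ f g h = pointwise λ n →
  trans (∑-cong (upTo (suc n)) (λ i → ℤ.*-distribˡ-+ (f i) (g (n ∸ i)) (h (n ∸ i))))
        (∑-+ (upTo (suc n)) (λ i → f i ℤ.* g (n ∸ i)) (λ i → f i ℤ.* h (n ∸ i)))

≈-trans : ∀ {f g h} → f ≈ g → g ≈ h → f ≈ h
≈-trans p q = pointwise λ n → trans (at p n) (at q n)

seriesRing : CommutativeRing 0ℓ 0ℓ
seriesRing = record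
  { Carrier = Series ; _≈_ = _≈_ ; _+_ = _+S_ ; _*_ = _*S_ ; -_ = negS ; 0# = zeroS ; 1# = oneS
  ; isCommutativeRing = record
    { isRing = record
      { +-isAbelianGroup = record
        { isGroup = record
          { isMonoid = record
            { isSemigroup = record
              { isMagma = record
                { isEquivalence = record
                  { refl = pointwise λ _ → refl
                  ; sym = λ p → pointwise λ n → sym (at p n)
                  ; trans = ≈-trans }
                ; ∙-cong = λ p q → pointwise λ n → cong₂ ℤ._+_ (at p n) (at q n) }
              ; assoc = λ f g h → pointwise λ n → ℤ.+-assoc (f n) (g n) (h n) }
            ; identity = (λ f → pointwise λ n → ℤ.+-identityˡ (f n)) , (λ f → pointwise λ n → ℤ.+-identityʳ (f n)) }
          ; inverse = (λ f → pointwise λ n → ℤ.+-inverseˡ (f n)) , (λ f → pointwise λ n → ℤ.+-inverseʳ (f n))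
          ; ⁻¹-cong = λ p → pointwise λ n → cong ℤ.-_ (at p n) }
        ; comm = λ f g → pointwise λ n → ℤ.+-comm (f n) (g n) }
      ; *-cong = *S-cong
      ; *-assoc = *S-assoc
      ; *-identity = *S-identityˡ , λ f → ≈-trans (*S-comm f oneS) (*S-identityˡ f)
      ; distrib = *S-distribˡ , λ f g h → ≈-trans (*S-comm (g +S h) f) (≈-trans (*S-distribˡ f g h) (pointwise λ n → cong₂ ℤ._+_ (at (*S-comm f g) n) (at (*S-comm f h) n))) }
    ; *-comm = *S-comm } }

module SR = CommutativeRing seriesRing

almostSeriesRing : AlmostCommutativeRing 0ℓ 0ℓ
almostSeriesRing = fromCommutativeRing seriesRing

-- Sends 0 and 1 to zeroS and oneS on the nose, so that the solver's constants match those of the ring.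
embed : ℤ → Series
embed (+ 0) = zeroS
embed (+ 1) = oneS
embed c     = const c

embed-const : ∀ c → embed c ≈ const c
embed-const (+ 0)             = pointwise λ { zero → refl ; (suc n) → refl }
embed-const (+ 1)             = pointwise oneS-const
embed-const (+ suc (suc c))   = SR.refl
embed-const ℤ.-[1+ c ]        = SR.refl

-- Equality of series is undecidable, so the ring solver works with integer coefficients, whose
-- equality it can decide.
embedMorphism : CommutativeRing.rawRing ℤ.+-*-commutativeRing -Raw-AlmostCommutative⟶ almostSeriesRing
embedMorphism = record
  { ⟦_⟧ = embed
  ; +-homo = λ a b → SR.trans (embed-const (a ℤ.+ b)) (SR.trans (pointwise λ { zero → refl ; (suc n) → refl }) (SR.sym (SR.+-cong (embed-const a) (embed-const b))))
  ; *-homo = λ a b → SR.trans (embed-const (a ℤ.* b)) (SR.trans (pointwise λ n → sym (trans (const-*S a (const b) n) (scale a b n))) (SR.sym (SR.*-cong (embed-const a) (embed-const b))))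
  ; -‿homo = λ a → SR.trans (embed-const (ℤ.- a)) (SR.trans (pointwise λ { zero → refl ; (suc n) → refl }) (SR.sym (SR.-‿cong (embed-const a))))
  ; 0-homo = SR.refl
  ; 1-homo = SR.refl }
  where
  scale : ∀ a b n → a ℤ.* const b n ≡ const (a ℤ.* b) n
  scale a b zero    = refl
  scale a b (suc n) = ℤ.*-zeroʳ a

embed-≟ : (a b : ℤ) → Maybe (embed a ≈ embed b)
embed-≟ a b with a ℤ.≟ b
... | yes refl = just SR.refl
... | no  _    = nothing

module Solver = Algebra.Solver.Ring _ almostSeriesRing embedMorphism embed-≟

open SR using (_+_; _*_; _-_)
open Solver using (solve; con; _:+_; _:*_; _:-_; _:=_)

module ≈-Reasoning = Relation.Binary.Reasoning.Setoid SR.setoid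

-- Congruences with the fixed side explicit: the series operations unfold, so it is never inferred.
+ˡ : ∀ x {y z} → y ≈ z → (x + y) ≈ (x + z)
+ˡ x = SR.+-congˡ {x}

+ʳ : ∀ x {y z} → y ≈ z → (y + x) ≈ (z + x)
+ʳ x = SR.+-congʳ {x}

-ˡ : ∀ x {y z} → y ≈ z → (x - y) ≈ (x - z)
-ˡ x p = SR.+-congˡ {x} (SR.-‿cong p)

*ˡ : ∀ x {y z} → y ≈ z → (x * y) ≈ (x * z)
*ˡ x = SR.*-congˡ {x}

*ʳ : ∀ x {y z} → y ≈ z → (y * x) ≈ (z * x)
*ʳ x = SR.*-congʳ {x}

-- Conditionals, and sums over filtered and concatenated lists

if-yes : ∀ {P : Set} (d : Dec P) {x y : A} → P → (if ⌊ d ⌋ then x else y) ≡ x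
if-yes (yes _) p = refl
if-yes (no ¬p) p = contradiction p ¬p

if-no : ∀ {P : Set} (d : Dec P) {x y : A} → ¬ P → (if ⌊ d ⌋ then x else y) ≡ y
if-no (yes p) ¬p = contradiction p ¬p
if-no (no _)  ¬p = refl

if-⇔ : ∀ {P Q : Set} (d : Dec P) (e : Dec Q) {x y : A} → (P → Q) → (Q → P) →
       (if ⌊ d ⌋ then x else y) ≡ (if ⌊ e ⌋ then x else y)
if-⇔ (yes p) e f g = sym (if-yes e (f p))
if-⇔ (no ¬p) e f g = sym (if-no e (¬p ∘ g))

∑-concatMap : ∀ (φ : B → List A) (xs : List B) (f : A → ℤ) → ∑ (concatMap φ xs) f ≡ ∑ xs (λ x → ∑ (φ x) f)
∑-concatMap φ []       f = refl
∑-concatMap φ (x ∷ xs) f = trans (∑-++ (φ x) (concatMap φ xs) f) (cong (λ s → ∑ (φ x) f ℤ.+ s) (∑-concatMap φ xs f))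

∑-filter : ∀ {P : A → Set} (P? : ∀ x → Dec (P x)) (xs : List A) (f : A → ℤ) →
  ∑ (filter P? xs) f ≡ ∑ xs (λ x → if ⌊ P? x ⌋ then f x else 0ℤ)
∑-filter P? []       f = refl
∑-filter P? (x ∷ xs) f with P? x
... | yes _ = cong (λ s → f x ℤ.+ s) (∑-filter P? xs f)
... | no  _ = trans (∑-filter P? xs f) (sym (ℤ.+-identityˡ _))

∑-upTo-extend : ∀ (f : ℕ → ℤ) m d → (∀ t → m ≤ t → f t ≡ 0ℤ) → ∑ (upTo (m ℕ.+ d)) f ≡ ∑ (upTo m) f
∑-upTo-extend f zero zero    z = refl
∑-upTo-extend f zero (suc d) z =
  trans (∑-upTo-suc f d) (trans (cong₂ ℤ._+_ (z 0 z≤n) (∑-upTo-extend (f ∘ suc) zero d (λ t _ → z (suc t) z≤n))) refl)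
∑-upTo-extend f (suc m) d z =
  trans (∑-upTo-suc f (m ℕ.+ d)) (trans (cong (λ s → f 0 ℤ.+ s) (∑-upTo-extend (f ∘ suc) m d (λ t p → z (suc t) (s≤s p)))) (sym (∑-upTo-suc f m)))

-- Multiplication by a power of q

shift : ℕ → Series → Series
shift zero    f n       = f n
shift (suc a) f zero    = 0ℤ
shift (suc a) f (suc n) = shift a f n

shift-+ : ∀ a b f n → shift (a ℕ.+ b) f n ≡ shift a (shift b f) n
shift-+ zero    b f n       = refl
shift-+ (suc a) b f zero    = refl
shift-+ (suc a) b f (suc n) = shift-+ a b f n

shift-at : ∀ a f n → shift a f (a ℕ.+ n) ≡ f n
shift-at zero    f n = refl
shift-at (suc a) f n = shift-at a f n

shift-≥ : ∀ {a n} f → a ≤ n → shift a f n ≡ f (n ∸ a)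
shift-≥ f z≤n     = refl
shift-≥ f (s≤s p) = shift-≥ f p

shift-< : ∀ {a n} f → n < a → shift a f n ≡ 0ℤ
shift-< f (s≤s z≤n)       = refl
shift-< f (s≤s p@(s≤s _)) = shift-< f p

conv-shift : ∀ a (h : ℕ → ℕ → ℤ) n → conv (λ i j → shift a (λ i′ → h i′ j) i) n ≡ shift a (conv h) n
conv-shift zero    h n       = refl
conv-shift (suc a) h zero    = refl
conv-shift (suc a) h (suc n) = trans (ℤ.+-identityˡ _) (conv-shift a h n)

qPow-suc : ∀ a n → qPow (suc a) (suc n) ≡ qPow a n
qPow-suc a n = if-⇔ (suc n ≟ suc a) (n ≟ a) ℕ.suc-injective (cong suc)

qPow-zero : qPow 0 ≈ oneS
qPow-zero = pointwise λ { zero → refl ; (suc n) → refl }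

qPow-* : ∀ a f → (qPow a * f) ≈ shift a f
qPow-* zero    f = SR.trans (*ʳ f qPow-zero) (SR.trans (SR.*-identityˡ f) (pointwise λ _ → refl))
qPow-* (suc a) f = pointwise go
  where
  open ≡-Reasoning
  go : ∀ n → (qPow (suc a) * f) n ≡ shift (suc a) f n
  go zero    = *S-conv (qPow (suc a)) f 0
  go (suc n) = begin
    (qPow (suc a) * f) (suc n)
      ≡⟨ *S-conv (qPow (suc a)) f (suc n) ⟩
    0ℤ ℤ.+ conv (λ i j → qPow (suc a) (suc i) ℤ.* f j) n
      ≡⟨ ℤ.+-identityˡ _ ⟩
    conv (λ i j → qPow (suc a) (suc i) ℤ.* f j) n
      ≡⟨ conv-cong (λ i j → cong (ℤ._* f j) (qPow-suc a i)) n ⟩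
    conv (λ i j → qPow a i ℤ.* f j) n
      ≡⟨ sym (*S-conv (qPow a) f n) ⟩
    (qPow a * f) n
      ≡⟨ at (qPow-* a f) n ⟩
    shift a f n ∎

qPow-+ : ∀ a b → (qPow a * qPow b) ≈ qPow (a ℕ.+ b)
qPow-+ a b = SR.trans (qPow-* a (qPow b)) (pointwise (go a))
  where
  go : ∀ a n → shift a (qPow b) n ≡ qPow (a ℕ.+ b) n
  go zero    n       = refl
  go (suc a) zero    = refl
  go (suc a) (suc n) = trans (go a n) (sym (qPow-suc (a ℕ.+ b) n))

-- Divisibility by `suc a` is periodic with that period, so the two terms of i - q^(a+1) i cancel
-- from degree a + 1 on; below it, 0 is the only multiple.
inv-oneMinusQ : ∀ a → (oneMinusQ (suc a) * invOneMinusQ (suc a)) ≈ oneS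
inv-oneMinusQ a = SR.trans (expand (qPow (suc a)) i) (SR.trans (-ˡ i (qPow-* (suc a) i)) (pointwise geometric))
  where
  i : Series
  i = invOneMinusQ (suc a)
  expand : ∀ q i → ((oneS - q) * i) ≈ (i - q * i)
  expand = solve 2 (λ q i → (con 1ℤ :- q) :* i := i :- q :* i) SR.refl
  periodic : ∀ n → i (suc a ℕ.+ n) ≡ i n
  periodic n = if-⇔ (suc a ∣? suc a ℕ.+ n) (suc a ∣? n) (λ d → ∣m+n∣m⇒∣n d ∣-refl) (∣m∣n⇒∣m+n ∣-refl)
  geometric : ∀ n → i n ℤ.- shift (suc a) i n ≡ oneS n
  geometric n with suc a ≤? n
  geometric zero    | no _ = cong (λ x → x ℤ.+ 0ℤ) (if-yes (suc a ∣? 0) {1ℤ} {0ℤ} (suc a ∣0))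
  geometric (suc n) | no ¬p = cong₂ (λ x y → x ℤ.- y) (if-no (suc a ∣? suc n) (¬p ∘ ∣⇒≤)) (shift-< i (ℕ.≰⇒> ¬p))
  geometric n@(suc _) | yes p with n ∸ suc a | ℕ.m+[n∸m]≡n p
  ... | m | refl = trans (cong₂ (λ x y → x ℤ.- y) (periodic m) (shift-at a i m)) (ℤ.+-inverseʳ (i m))

-- Weighted sums over partitions with bounded parts

partSum : ℕ → (List ℕ → ℤ) → Series
partSum b g n = ∑ (partsLE b n) g

-- The guard in `partsLE` becomes the vanishing of `shift` below its offset, so the multiplicity t
-- of the part `suc b` may run over the whole list.
partSum-multiplicities : ∀ b g n →
  partSum (suc b) g n ≡ ∑ (upTo (suc n)) (λ t → shift (t ℕ.* suc b) (partSum b (g ∘ (replicate t (suc b) ++_))) n)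
partSum-multiplicities b g n = begin
  ∑ (concatMap φ (filter fits? (upTo (suc n)))) g
    ≡⟨ ∑-concatMap φ (filter fits? (upTo (suc n))) g ⟩
  ∑ (filter fits? (upTo (suc n))) (λ t → ∑ (φ t) g)
    ≡⟨ ∑-filter fits? (upTo (suc n)) (λ t → ∑ (φ t) g) ⟩
  ∑ (upTo (suc n)) (λ t → if ⌊ fits? t ⌋ then ∑ (φ t) g else 0ℤ)
    ≡⟨ ∑-cong (upTo (suc n)) term ⟩
  ∑ (upTo (suc n)) (λ t → shift (t ℕ.* suc b) (partSum b (g ∘ (replicate t (suc b) ++_))) n) ∎
  where
  open ≡-Reasoning
  fits? : ∀ t → Dec (t ℕ.* suc b ≤ n)
  fits? t = t ℕ.* suc b ≤? n
  φ : ℕ → List (List ℕ)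
  φ t = map (replicate t (suc b) ++_) (partsLE b (n ∸ t ℕ.* suc b))
  term : ∀ t → (if ⌊ fits? t ⌋ then ∑ (φ t) g else 0ℤ) ≡ shift (t ℕ.* suc b) (partSum b (g ∘ (replicate t (suc b) ++_))) n
  term t with fits? t
  ... | yes p = trans (∑-map (replicate t (suc b) ++_) (partsLE b (n ∸ t ℕ.* suc b)) g) (sym (shift-≥ (partSum b (g ∘ (replicate t (suc b) ++_))) p))
  ... | no ¬p = sym (shift-< (partSum b (g ∘ (replicate t (suc b) ++_))) (ℕ.≰⇒> ¬p))

-- Either `suc b` does not occur, or one copy of it is removed and may occur again. This one-part
-- recursion is what every later induction on partitions uses, in place of the enumeration by
-- multiplicities.
partSum-suc : ∀ b g n →
  partSum (suc b) g n ≡ partSum b g n ℤ.+ shift (suc b) (partSum (suc b) (g ∘ (suc b ∷_))) n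
partSum-suc b g n = begin
  partSum (suc b) g n
    ≡⟨ partSum-multiplicities b g n ⟩
  ∑ (upTo (suc n)) (λ t → shift (t ℕ.* suc b) (F g t) n)
    ≡⟨ ∑-upTo-suc (λ t → shift (t ℕ.* suc b) (F g t) n) n ⟩
  partSum b g n ℤ.+ ∑ (upTo n) (λ t → shift (suc b ℕ.+ t ℕ.* suc b) (F g (suc t)) n)
    ≡⟨ cong (λ s → partSum b g n ℤ.+ s) (tails n) ⟩
  partSum b g n ℤ.+ shift (suc b) (partSum (suc b) g′) n ∎
  where
  open ≡-Reasoning
  F : (List ℕ → ℤ) → ℕ → Series
  F h t = partSum b (h ∘ (replicate t (suc b) ++_))
  g′ : List ℕ → ℤ
  g′ = g ∘ (suc b ∷_)
  vanish : ∀ m t → suc m ≤ t → shift (t ℕ.* suc b) (F g′ t) m ≡ 0ℤ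
  vanish m t p = shift-< (F g′ t) (ℕ.≤-trans p (ℕ.m≤m*n t (suc b)))
  tails : ∀ n → ∑ (upTo n) (λ t → shift (suc b ℕ.+ t ℕ.* suc b) (F g (suc t)) n) ≡ shift (suc b) (partSum (suc b) g′) n
  tails n with suc b ≤? n
  ... | no ¬p = trans (∑-cong (upTo n) (λ t → shift-< (F g (suc t)) (ℕ.<-≤-trans (ℕ.≰⇒> ¬p) (ℕ.m≤m+n (suc b) (t ℕ.* suc b)))))
                      (trans (∑-zero (upTo n)) (sym (shift-< (partSum (suc b) g′) (ℕ.≰⇒> ¬p))))
  ... | yes p with n ∸ suc b | ℕ.m+[n∸m]≡n p
  ... | m | refl = begin
    ∑ (upTo (suc b ℕ.+ m)) (λ t → shift (suc b ℕ.+ t ℕ.* suc b) (F g′ t) (suc b ℕ.+ m))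
      ≡⟨ ∑-cong (upTo (suc b ℕ.+ m)) (λ t → trans (shift-+ (suc b) (t ℕ.* suc b) (F g′ t) (suc b ℕ.+ m)) (shift-at (suc b) (shift (t ℕ.* suc b) (F g′ t)) m)) ⟩
    ∑ (upTo (suc b ℕ.+ m)) (λ t → shift (t ℕ.* suc b) (F g′ t) m)
      ≡⟨ cong (λ k → ∑ (upTo (suc k)) (λ t → shift (t ℕ.* suc b) (F g′ t) m)) (ℕ.+-comm b m) ⟩
    ∑ (upTo (suc m ℕ.+ b)) (λ t → shift (t ℕ.* suc b) (F g′ t) m)
      -- The list is longer than the one in `partSum-multiplicities` at m; each surplus t exceeds m,
      -- so t parts `suc b` weigh too much and the term is 0.
      ≡⟨ ∑-upTo-extend (λ t → shift (t ℕ.* suc b) (F g′ t) m) (suc m) b (vanish m) ⟩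
    ∑ (upTo (suc m)) (λ t → shift (t ℕ.* suc b) (F g′ t) m)
      ≡⟨ sym (partSum-multiplicities b g′ m) ⟩
    partSum (suc b) g′ m
      ≡⟨ sym (shift-at (suc b) (partSum (suc b) g′) m) ⟩
    shift (suc b) (partSum (suc b) g′) (suc b ℕ.+ m) ∎

-- The series Σ q^|π| · `g π` over partitions π with parts ≤ b. The weight is itself a series, so
-- that a second partition can be summed inside.
partSeries : ℕ → (List ℕ → Series) → Series
partSeries b g = conv (λ i j → partSum b (λ π → g π j) i)

partSeries-cong : ∀ b {g h : List ℕ → Series} → (∀ π → g π ≈ h π) → partSeries b g ≈ partSeries b h
partSeries-cong b e = pointwise (conv-cong λ i j → ∑-cong (partsLE b i) (λ π → at (e π) j))

partSeries-zero : ∀ g → partSeries 0 g ≈ g []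
partSeries-zero g = pointwise (go (λ i j → partSum 0 (λ π → g π j) i) (λ j → ℤ.+-identityʳ (g [] j)) (λ i j → refl))
  where
  go : ∀ (h : ℕ → ℕ → ℤ) {f : Series} → (∀ j → h 0 j ≡ f j) → (∀ i j → h (suc i) j ≡ 0ℤ) → ∀ n → conv h n ≡ f n
  go h e z zero    = e 0
  go h e z (suc n) = trans (cong₂ ℤ._+_ (e (suc n)) (trans (conv-cong z n) (conv-zero n))) (ℤ.+-identityʳ _)

partSeries-suc : ∀ b g → partSeries (suc b) g ≈ (partSeries b g + qPow (suc b) * partSeries (suc b) (g ∘ (suc b ∷_)))
partSeries-suc b g = SR.trans (pointwise λ n → begin
  partSeries (suc b) g n
    ≡⟨ conv-cong (λ i j → partSum-suc b (λ π → g π j) i) n ⟩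
  conv (λ i j → partSum b (λ π → g π j) i ℤ.+ shift (suc b) (partSum (suc b) (λ π → g (suc b ∷ π) j)) i) n
    ≡⟨ conv-+ (λ i j → partSum b (λ π → g π j) i) (λ i j → shift (suc b) (partSum (suc b) (λ π → g (suc b ∷ π) j)) i) n ⟩
  partSeries b g n ℤ.+ conv (λ i j → shift (suc b) (partSum (suc b) (λ π → g (suc b ∷ π) j)) i) n
    ≡⟨ cong (λ s → partSeries b g n ℤ.+ s) (conv-shift (suc b) (λ i j → partSum (suc b) (λ π → g (suc b ∷ π) j) i) n) ⟩
  partSeries b g n ℤ.+ shift (suc b) (partSeries (suc b) (g ∘ (suc b ∷_))) n ∎)
  (+ˡ (partSeries b g) (SR.sym (qPow-* (suc b) (partSeries (suc b) (g ∘ (suc b ∷_))))))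
  where open ≡-Reasoning

-- Σ f(#σ − #τ) q^(|σ| + |τ|) over partitions σ, τ with parts ≤ a and ≤ b

crankSum : ℕ → ℕ → (ℤ → ℤ) → Series
crankSum a b f = partSeries a (λ σ → partSum b (λ τ → f (crank σ τ)))

crankSum-cong : ∀ a b {f g : ℤ → ℤ} → (∀ m → f m ≡ g m) → crankSum a b f ≈ crankSum a b g
crankSum-cong a b e = partSeries-cong a λ σ → pointwise λ n → ∑-cong (partsLE b n) (λ τ → e (crank σ τ))

crankSum-+ : ∀ a b f g → crankSum a b (λ m → f m ℤ.+ g m) ≈ (crankSum a b f + crankSum a b g)
crankSum-+ a b f g = pointwise λ n →
  trans (conv-cong (λ i j → trans (∑-cong (partsLE a i) (λ σ → ∑-+ (partsLE b j) (λ τ → f (crank σ τ)) (λ τ → g (crank σ τ))))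
                                  (∑-+ (partsLE a i) (λ σ → partSum b (λ τ → f (crank σ τ)) j) (λ σ → partSum b (λ τ → g (crank σ τ)) j))) n)
        (conv-+ (λ i j → ∑ (partsLE a i) (λ σ → partSum b (λ τ → f (crank σ τ)) j)) _ n)

-- Exchanging σ and τ negates the crank; the recursion in the second bound is thereby deduced from
-- the one in the first.
crankSum-flip : ∀ a b f → crankSum a b f ≈ crankSum b a (λ m → f (ℤ.- m))
crankSum-flip a b f = pointwise λ n →
  trans (conv-flip (λ i j → ∑ (partsLE a i) (λ σ → partSum b (λ τ → f (crank σ τ)) j)) n)
        (conv-cong (λ i j → trans (∑-swap (partsLE a j) (partsLE b i) (λ σ τ → f (crank σ τ)))
                                  (∑-cong (partsLE b i) (λ τ → ∑-cong (partsLE a j) (λ σ → cong f (neg-minus (+ length σ) (+ length τ)))))) n)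
  where
  neg-minus : ∀ x y → x ℤ.- y ≡ ℤ.- (y ℤ.- x)
  neg-minus = solve-∀

crankSum-zero : ∀ f → crankSum 0 0 f ≈ const (f 0ℤ)
crankSum-zero f = SR.trans (partSeries-zero (λ σ → partSum 0 (λ τ → f (crank σ τ))))
  (pointwise λ { zero → ℤ.+-identityʳ (f 0ℤ) ; (suc n) → refl })

crankSum-sucˡ : ∀ a b f →
  crankSum (suc a) b f ≈ (crankSum a b f + qPow (suc a) * crankSum (suc a) b (λ m → f (m ℤ.+ 1ℤ)))
crankSum-sucˡ a b f = SR.trans (partSeries-suc a (λ σ → partSum b (λ τ → f (crank σ τ))))
  (+ˡ (crankSum a b f) (*ˡ (qPow (suc a)) (partSeries-cong (suc a) λ σ → pointwise λ n →
    ∑-cong (partsLE b n) (λ τ → cong f (suc-minus (+ length σ) (+ length τ))))))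
  where
  suc-minus : ∀ x y → (1ℤ ℤ.+ x) ℤ.- y ≡ (x ℤ.- y) ℤ.+ 1ℤ
  suc-minus = solve-∀

crankSum-sucʳ : ∀ a b f →
  crankSum a (suc b) f ≈ (crankSum a b f + qPow (suc b) * crankSum a (suc b) (λ m → f (m ℤ.- 1ℤ)))
crankSum-sucʳ a b f = SR.trans (crankSum-flip a (suc b) f) (SR.trans (crankSum-sucˡ b a (λ m → f (ℤ.- m)))
  (SR.+-cong (SR.sym (crankSum-flip a b f))
    (*ˡ (qPow (suc b)) (SR.trans (crankSum-cong (suc b) a (λ m → cong f (neg-suc m))) (SR.sym (crankSum-flip a (suc b) (λ m → f (m ℤ.- 1ℤ))))))))
  where
  neg-suc : ∀ m → ℤ.- (m ℤ.+ 1ℤ) ≡ ℤ.- m ℤ.- 1ℤ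
  neg-suc = solve-∀

-- With `u⁺`, `u⁻` the sums for the two translates of `f`, the left side is u - q u⁺ - q (u⁻ - q u),
-- the product of 1 - z q and 1 - q/z applied to u. The first bound is lowered in both brackets, u -
-- q u⁺ = m and u⁻ - q u = m⁻, and then the second bound in m - q m⁻.
crankSum-second-difference : ∀ n {f d : ℤ → ℤ} →
  (∀ m → f (m ℤ.+ 1ℤ) ℤ.+ f (m ℤ.- 1ℤ) ≡ (f m ℤ.+ f m) ℤ.+ d m) →
  (oneMinusQ (suc n) * oneMinusQ (suc n) * crankSum (suc n) (suc n) f - qPow (suc n) * crankSum (suc n) (suc n) d) ≈ crankSum n n f
crankSum-second-difference n {f} {d} Δ = begin
  (1-q * 1-q * u - q * v)
    ≈⟨ rearrange q u v ⟩
  (u - q * ((u + u) + v) + q * q * u)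
    ≈⟨ +ʳ (q * q * u) (-ˡ u (*ˡ q (SR.sym u-sum))) ⟩
  (u - q * (u⁺ + u⁻) + q * q * u)
    ≈⟨ +ʳ (q * q * u) (SR.+-cong (crankSum-sucˡ n (suc n) f) (SR.-‿cong (*ˡ q (+ˡ u⁺ step⁻)))) ⟩
  ((m + q * u⁺) - q * (u⁺ + (m⁻ + q * u)) + q * q * u)
    ≈⟨ cancel q m u⁺ m⁻ u ⟩
  (m - q * m⁻)
    ≈⟨ +ʳ (SR.- (q * m⁻)) (crankSum-sucʳ n n f) ⟩
  ((crankSum n n f + q * m⁻) - q * m⁻)
    ≈⟨ cancel′ (crankSum n n f) (q * m⁻) ⟩
  crankSum n n f ∎
  where
  open ≈-Reasoning
  q = qPow (suc n)
  1-q = oneMinusQ (suc n)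
  f⁺ f⁻ : ℤ → ℤ
  f⁺ x = f (x ℤ.+ 1ℤ)
  f⁻ x = f (x ℤ.- 1ℤ)
  u = crankSum (suc n) (suc n) f
  v = crankSum (suc n) (suc n) d
  u⁺ = crankSum (suc n) (suc n) f⁺
  u⁻ = crankSum (suc n) (suc n) f⁻
  m = crankSum n (suc n) f
  m⁻ = crankSum n (suc n) f⁻
  u-sum : (u⁺ + u⁻) ≈ ((u + u) + v)
  u-sum = SR.trans (SR.sym (crankSum-+ (suc n) (suc n) f⁺ f⁻)) (SR.trans (crankSum-cong (suc n) (suc n) Δ)
          (SR.trans (crankSum-+ (suc n) (suc n) (λ x → f x ℤ.+ f x) d) (+ʳ v (crankSum-+ (suc n) (suc n) f f))))
  plus-minus : ∀ x → (x ℤ.+ 1ℤ) ℤ.- 1ℤ ≡ x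
  plus-minus = solve-∀
  step⁻ : u⁻ ≈ (m⁻ + q * u)
  step⁻ = SR.trans (crankSum-sucˡ n (suc n) f⁻) (+ˡ m⁻ (*ˡ q (crankSum-cong (suc n) (suc n) (λ x → cong f (plus-minus x)))))
  rearrange : ∀ q u v → ((oneS - q) * (oneS - q) * u - q * v) ≈ (u - q * ((u + u) + v) + q * q * u)
  rearrange = solve 3 (λ q u v → (con 1ℤ :- q) :* (con 1ℤ :- q) :* u :- q :* v := u :- q :* ((u :+ u) :+ v) :+ q :* q :* u) SR.refl
  cancel : ∀ q m u⁺ m⁻ u → ((m + q * u⁺) - q * (u⁺ + (m⁻ + q * u)) + q * q * u) ≈ (m - q * m⁻)
  cancel = solve 5 (λ q m u⁺ m⁻ u → (m :+ q :* u⁺) :- q :* (u⁺ :+ (m⁻ :+ q :* u)) :+ q :* q :* u := m :- q :* m⁻) SR.refl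
  cancel′ : ∀ k x → ((k + x) - x) ≈ k
  cancel′ = solve 2 (λ k x → (k :+ x) :- x := k) SR.refl

-- Integer binomial coefficients

falling-last : ∀ x k → falling x (suc k) ≡ falling x k ℤ.* (x ℤ.- + k)
falling-last x zero    = base x
  where
  base : ∀ x → x ℤ.* 1ℤ ≡ 1ℤ ℤ.* (x ℤ.- 0ℤ)
  base = solve-∀
falling-last x (suc k) = trans (cong (x ℤ.*_) (falling-last (x ℤ.- 1ℤ) k)) (step x (falling (x ℤ.- 1ℤ) k) (+ k))
  where
  step : ∀ x f k → x ℤ.* (f ℤ.* (x ℤ.- 1ℤ ℤ.- k)) ≡ x ℤ.* f ℤ.* (x ℤ.- (1ℤ ℤ.+ k))
  step = solve-∀

falling-suc : ∀ x k → falling (x ℤ.+ 1ℤ) (suc k) ≡ falling x (suc k) ℤ.+ + suc k ℤ.* falling x k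
falling-suc x k = begin
  (x ℤ.+ 1ℤ) ℤ.* falling (x ℤ.+ 1ℤ ℤ.- 1ℤ) k                     ≡⟨ cong (λ y → (x ℤ.+ 1ℤ) ℤ.* falling y k) (cancel x) ⟩
  (x ℤ.+ 1ℤ) ℤ.* falling x k                                     ≡⟨ split x (falling x k) (+ k) ⟩
  falling x k ℤ.* (x ℤ.- + k) ℤ.+ (1ℤ ℤ.+ + k) ℤ.* falling x k   ≡⟨ cong (λ s → s ℤ.+ + suc k ℤ.* falling x k) (sym (falling-last x k)) ⟩
  falling x (suc k) ℤ.+ + suc k ℤ.* falling x k                  ∎
  where
  open ≡-Reasoning
  cancel : ∀ x → x ℤ.+ 1ℤ ℤ.- 1ℤ ≡ x
  cancel = solve-∀
  split : ∀ x f k → (x ℤ.+ 1ℤ) ℤ.* f ≡ f ℤ.* (x ℤ.- k) ℤ.+ (1ℤ ℤ.+ k) ℤ.* f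
  split = solve-∀

falling-vanish : ∀ {n k} → n < k → falling (+ n) k ≡ 0ℤ
falling-vanish {zero}  (s≤s z≤n)       = refl
falling-vanish {suc n} (s≤s p@(s≤s _)) = trans (cong (+ suc n ℤ.*_) (falling-vanish p)) (ℤ.*-zeroʳ (+ suc n))

ℤ-induction : (P : ℤ → Set) → P 0ℤ → (∀ x → P x → P (x ℤ.+ 1ℤ)) → (∀ x → P (x ℤ.+ 1ℤ) → P x) → ∀ x → P x
ℤ-induction P z up down (+ zero)        = z
ℤ-induction P z up down (+ suc n)       = subst P (cong +_ (ℕ.+-comm n 1)) (up (+ n) (ℤ-induction P z up down (+ n)))
ℤ-induction P z up down -[1+ zero ]     = down -[1+ zero ] z
ℤ-induction P z up down -[1+ suc n ]    = down -[1+ suc n ] (ℤ-induction P z up down -[1+ n ])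

-- By `falling-suc`, passing from x to x + 1 adds (k + 1) · `falling x k`, a multiple of (k + 1)! by
-- induction on k; starting from the value 0 at x = 0, divisibility spreads in both directions.
-- Since `binom` is defined by integer division, Pascal's rule rests on this exactness.
!∣falling : ∀ k x → ∃ λ c → falling x k ≡ c ℤ.* + (k !)
!∣falling zero    x = 1ℤ , refl
!∣falling (suc k) = ℤ-induction (λ x → ∃ λ c → falling x (suc k) ≡ c ℤ.* + (suc k !)) (0ℤ , refl) up down
  where
  open ≡-Reasoning
  c : ℤ → ℤ
  c x = proj₁ (!∣falling k x)
  factor : ∀ x → + suc k ℤ.* falling x k ≡ c x ℤ.* + (suc k !)
  factor x = begin
    + suc k ℤ.* falling x k         ≡⟨ cong (+ suc k ℤ.*_) (proj₂ (!∣falling k x)) ⟩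
    + suc k ℤ.* (c x ℤ.* + (k !))   ≡⟨ exchange (+ suc k) (c x) (+ (k !)) ⟩
    c x ℤ.* (+ suc k ℤ.* + (k !))   ≡⟨ cong (c x ℤ.*_) (sym (ℤ.pos-* (suc k) (k !))) ⟩
    c x ℤ.* + (suc k !)             ∎
    where
    exchange : ∀ a b c → a ℤ.* (b ℤ.* c) ≡ b ℤ.* (a ℤ.* c)
    exchange = solve-∀
  up : ∀ x → (∃ λ d → falling x (suc k) ≡ d ℤ.* + (suc k !)) → ∃ λ d → falling (x ℤ.+ 1ℤ) (suc k) ≡ d ℤ.* + (suc k !)
  up x (d , e) = d ℤ.+ c x , trans (falling-suc x k) (trans (cong₂ ℤ._+_ e (factor x)) (sym (ℤ.*-distribʳ-+ (+ (suc k !)) d (c x))))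
  down : ∀ x → (∃ λ d → falling (x ℤ.+ 1ℤ) (suc k) ≡ d ℤ.* + (suc k !)) → ∃ λ d → falling x (suc k) ≡ d ℤ.* + (suc k !)
  down x (d , e) = d ℤ.- c x , (begin
    falling x (suc k)                                          ≡⟨ add-sub (falling x (suc k)) (c x ℤ.* + (suc k !)) ⟩
    falling x (suc k) ℤ.+ c x ℤ.* + (suc k !) ℤ.- c x ℤ.* + (suc k !)
      ≡⟨ cong (λ s → falling x (suc k) ℤ.+ s ℤ.- c x ℤ.* + (suc k !)) (sym (factor x)) ⟩
    falling x (suc k) ℤ.+ + suc k ℤ.* falling x k ℤ.- c x ℤ.* + (suc k !)
      ≡⟨ cong (λ s → s ℤ.- c x ℤ.* + (suc k !)) (trans (sym (falling-suc x k)) e) ⟩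
    d ℤ.* + (suc k !) ℤ.- c x ℤ.* + (suc k !)                  ≡⟨ collect d (c x) (+ (suc k !)) ⟩
    (d ℤ.- c x) ℤ.* + (suc k !)                                ∎)
    where
    add-sub : ∀ a b → a ≡ a ℤ.+ b ℤ.- b
    add-sub = solve-∀
    collect : ∀ a b c → a ℤ.* c ℤ.- b ℤ.* c ≡ (a ℤ.- b) ℤ.* c
    collect = solve-∀

*-/ℕ : ∀ c d .{{_ : NonZero d}} → (c ℤ.* + d) /ℕ d ≡ c
*-/ℕ (+ n)    d = trans (cong (_/ℕ d) (sym (ℤ.pos-* n d))) (cong +_ (ℕ.m*n/n≡m n d))
*-/ℕ -[1+ n ] (suc d) rewrite ℕ.m*n%n≡0 (suc n) (suc d) {{_}} = cong (λ t → ℤ.- + t) (ℕ.m*n/n≡m (suc n) (suc d))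

binom-unique : ∀ x k c → falling x k ≡ c ℤ.* + (k !) → binom x k ≡ c
binom-unique x k c e = trans (cong (λ y → _/ℕ_ y (k !) {{k ℕ.!≢0}}) e) (*-/ℕ c (k !) {{k ℕ.!≢0}})

falling-binom : ∀ x k → falling x k ≡ binom x k ℤ.* + (k !)
falling-binom x k with !∣falling k x
... | c , e = trans e (cong (ℤ._* + (k !)) (sym (binom-unique x k c e)))

binom-pascal : ∀ x k → binom (x ℤ.+ 1ℤ) (suc k) ≡ binom x (suc k) ℤ.+ binom x k
binom-pascal x k = binom-unique (x ℤ.+ 1ℤ) (suc k) _ (begin
  falling (x ℤ.+ 1ℤ) (suc k)
    ≡⟨ falling-suc x k ⟩
  falling x (suc k) ℤ.+ + suc k ℤ.* falling x k
    ≡⟨ cong₂ (λ s t → s ℤ.+ + suc k ℤ.* t) (falling-binom x (suc k)) (falling-binom x k) ⟩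
  binom x (suc k) ℤ.* + (suc k !) ℤ.+ + suc k ℤ.* (binom x k ℤ.* + (k !))
    ≡⟨ cong (λ t → binom x (suc k) ℤ.* t ℤ.+ + suc k ℤ.* (binom x k ℤ.* + (k !))) (ℤ.pos-* (suc k) (k !)) ⟩
  binom x (suc k) ℤ.* (+ suc k ℤ.* + (k !)) ℤ.+ + suc k ℤ.* (binom x k ℤ.* + (k !))
    ≡⟨ collect (binom x (suc k)) (binom x k) (+ suc k) (+ (k !)) ⟩
  (binom x (suc k) ℤ.+ binom x k) ℤ.* (+ suc k ℤ.* + (k !))
    ≡⟨ cong ((binom x (suc k) ℤ.+ binom x k) ℤ.*_) (sym (ℤ.pos-* (suc k) (k !))) ⟩
  (binom x (suc k) ℤ.+ binom x k) ℤ.* + (suc k !) ∎)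
  where
  open ≡-Reasoning
  collect : ∀ a b c d → a ℤ.* (c ℤ.* d) ℤ.+ c ℤ.* (b ℤ.* d) ≡ (a ℤ.+ b) ℤ.* (c ℤ.* d)
  collect = solve-∀

binom-second-difference : ∀ y k →
  binom (y ℤ.+ 1ℤ ℤ.+ 1ℤ) (suc (suc k)) ℤ.+ binom y (suc (suc k))
    ≡ (binom (y ℤ.+ 1ℤ) (suc (suc k)) ℤ.+ binom (y ℤ.+ 1ℤ) (suc (suc k))) ℤ.+ binom y k
binom-second-difference y k = begin
  binom (y ℤ.+ 1ℤ ℤ.+ 1ℤ) (suc (suc k)) ℤ.+ binom y (suc (suc k))
    ≡⟨ cong (λ s → s ℤ.+ binom y (suc (suc k))) (trans (binom-pascal (y ℤ.+ 1ℤ) (suc k)) (cong (λ s → T ℤ.+ s) (binom-pascal y k))) ⟩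
  (T ℤ.+ (binom y (suc k) ℤ.+ binom y k)) ℤ.+ binom y (suc (suc k))
    ≡⟨ regroup T (binom y (suc k)) (binom y k) (binom y (suc (suc k))) ⟩
  (T ℤ.+ (binom y (suc (suc k)) ℤ.+ binom y (suc k))) ℤ.+ binom y k
    ≡⟨ cong (λ s → (T ℤ.+ s) ℤ.+ binom y k) (sym (binom-pascal y (suc k))) ⟩
  (T ℤ.+ T) ℤ.+ binom y k ∎
  where
  open ≡-Reasoning
  T = binom (y ℤ.+ 1ℤ) (suc (suc k))
  regroup : ∀ a b c d → (a ℤ.+ (b ℤ.+ c)) ℤ.+ d ≡ (a ℤ.+ (d ℤ.+ b)) ℤ.+ c
  regroup = solve-∀

momentWeight : ℕ → ℤ → ℤ
momentWeight k m = binom (m ℤ.+ + k ℤ.- 1ℤ) (2 ℕ.* k)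

-- Pascal's rule twice. The offset k - 1 in the weight is what makes the centred difference at m
-- land on `momentWeight k m` without displacement.
momentWeight-second-difference : ∀ k m →
  momentWeight (suc k) (m ℤ.+ 1ℤ) ℤ.+ momentWeight (suc k) (m ℤ.- 1ℤ)
    ≡ (momentWeight (suc k) m ℤ.+ momentWeight (suc k) m) ℤ.+ momentWeight k m
momentWeight-second-difference k m = begin
  momentWeight (suc k) (m ℤ.+ 1ℤ) ℤ.+ momentWeight (suc k) (m ℤ.- 1ℤ)
    ≡⟨ cong₂ (λ a b → a ℤ.+ b) (reindex (m ℤ.+ 1ℤ) (plus m (+ k))) (reindex (m ℤ.- 1ℤ) (minus m (+ k))) ⟩
  binom (y ℤ.+ 1ℤ ℤ.+ 1ℤ) (suc (suc (2 ℕ.* k))) ℤ.+ binom y (suc (suc (2 ℕ.* k)))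
    ≡⟨ binom-second-difference y (2 ℕ.* k) ⟩
  (T ℤ.+ T) ℤ.+ momentWeight k m
    ≡⟨ cong (λ b → (b ℤ.+ b) ℤ.+ momentWeight k m) (sym (reindex m (same m (+ k)))) ⟩
  (momentWeight (suc k) m ℤ.+ momentWeight (suc k) m) ℤ.+ momentWeight k m ∎
  where
  open ≡-Reasoning
  y = m ℤ.+ + k ℤ.- 1ℤ
  T = binom (y ℤ.+ 1ℤ) (suc (suc (2 ℕ.* k)))
  reindex : ∀ x {z} → x ℤ.+ + suc k ℤ.- 1ℤ ≡ z → momentWeight (suc k) x ≡ binom z (suc (suc (2 ℕ.* k)))
  reindex x e = cong₂ binom e (cong suc (ℕ.+-suc k (k ℕ.+ 0)))
  plus : ∀ m k → m ℤ.+ 1ℤ ℤ.+ (1ℤ ℤ.+ k) ℤ.- 1ℤ ≡ m ℤ.+ k ℤ.- 1ℤ ℤ.+ 1ℤ ℤ.+ 1ℤ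
  plus = solve-∀
  minus : ∀ m k → m ℤ.- 1ℤ ℤ.+ (1ℤ ℤ.+ k) ℤ.- 1ℤ ≡ m ℤ.+ k ℤ.- 1ℤ
  minus = solve-∀
  same : ∀ m k → m ℤ.+ (1ℤ ℤ.+ k) ℤ.- 1ℤ ≡ m ℤ.+ k ℤ.- 1ℤ ℤ.+ 1ℤ
  same = solve-∀

-- The upper entry is k, nonnegative and smaller than 2(k + 1). Hence moments of positive order do
-- not see objects of rank or crank 0, in particular the empty partition.
momentWeight-at-zero : ∀ k → momentWeight (suc k) 0ℤ ≡ 0ℤ
momentWeight-at-zero k = binom-unique (+ k) (2 ℕ.* suc k) 0ℤ (falling-vanish {k} (ℕ.m≤m+n (suc k) (suc k ℕ.+ 0)))

if-cong : ∀ {P Q : Set} (d : Dec P) (e : Dec Q) {x x′ y : A} → (P → Q) → (Q → P) → (P → x ≡ x′) →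
          (if ⌊ d ⌋ then x else y) ≡ (if ⌊ e ⌋ then x′ else y)
if-cong (yes p) e f g h = trans (h p) (sym (if-yes e (f p)))
if-cong (no ¬p) e f g h = sym (if-no e (¬p ∘ g))

∑-cong-All : ∀ {xs : List A} {f g : A → ℤ} → All (λ x → f x ≡ g x) xs → ∑ xs f ≡ ∑ xs g
∑-cong-All []       = refl
∑-cong-All (e ∷ es) = cong₂ ℤ._+_ e (∑-cong-All es)

-- Size and parts of the enumerated partitions

PartitionLE : ℕ → ℕ → List ℕ → Set
PartitionLE b n π = All (λ x → 1 ≤ x × x ≤ b) π × sum π ≡ n

partsLE-valid : ∀ b n → All (PartitionLE b n) (partsLE b n)
partsLE-valid zero    zero    = ([] , refl) ∷ []
partsLE-valid zero    (suc n) = []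
partsLE-valid (suc b) n =
  All.concat⁺ (All.map⁺ (All.map (λ {t} p → All.map⁺ (All.map (prepend t p) (partsLE-valid b (n ∸ t ℕ.* suc b))))
                                 (All.all-filter (λ t → t ℕ.* suc b ≤? n) (upTo (suc n)))))
  where
  sum-replicate : ∀ t x → sum (replicate t x) ≡ t ℕ.* x
  sum-replicate zero    x = refl
  sum-replicate (suc t) x = cong (x ℕ.+_) (sum-replicate t x)
  prepend : ∀ t → t ℕ.* suc b ≤ n → ∀ {π} → PartitionLE b (n ∸ t ℕ.* suc b) π → PartitionLE (suc b) n (replicate t (suc b) ++ π)
  prepend t p {π} (parts , e) =
    All.++⁺ (All.replicate⁺ t (s≤s z≤n , ℕ.≤-refl)) (All.map (λ (lo , hi) → lo , ℕ.m≤n⇒m≤1+n hi) parts) ,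
    trans (sum-++ (replicate t (suc b)) π) (trans (cong₂ ℕ._+_ (sum-replicate t (suc b)) e) (ℕ.m+[n∸m]≡n p))

partSum-cong : ∀ b n {g h : List ℕ → ℤ} → (∀ π → All (_≤ b) π → g π ≡ h π) → partSum b g n ≡ partSum b h n
partSum-cong b n e = ∑-cong-All (All.map (λ {π} (parts , _) → e π (All.map proj₂ parts)) (partsLE-valid b n))

partSum-stable : ∀ e {b n} g → n ≤ b → partSum (e ℕ.+ b) g n ≡ partSum b g n
partSum-stable zero    g p = refl
partSum-stable (suc e) {b} {n} g p = begin
  partSum (suc (e ℕ.+ b)) g n
    ≡⟨ partSum-suc (e ℕ.+ b) g n ⟩
  partSum (e ℕ.+ b) g n ℤ.+ shift (suc (e ℕ.+ b)) (partSum (suc (e ℕ.+ b)) (g ∘ (suc (e ℕ.+ b) ∷_))) n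
    ≡⟨ cong₂ ℤ._+_ (partSum-stable e g p) (shift-< (partSum (suc (e ℕ.+ b)) (g ∘ (suc (e ℕ.+ b) ∷_))) (s≤s (ℕ.≤-trans p (ℕ.m≤n+m b e)))) ⟩
  partSum b g n ℤ.+ 0ℤ
    ≡⟨ ℤ.+-identityʳ _ ⟩
  partSum b g n ∎
  where open ≡-Reasoning

partSum-suc-* : ∀ b g → partSum (suc b) g ≈ (partSum b g + qPow (suc b) * partSum (suc b) (g ∘ (suc b ∷_)))
partSum-suc-* b g = SR.trans (pointwise (partSum-suc b g)) (+ˡ (partSum b g) (SR.sym (qPow-* (suc b) (partSum (suc b) (g ∘ (suc b ∷_))))))

-- Durfee squares

largest-closed : ∀ {P : ℕ → Set} {xs} → P 0 → All P xs → P (largest xs)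
largest-closed z [] = z
largest-closed {P} {x ∷ xs} z (p ∷ ps) with ℕ.⊔-sel x (largest xs)
... | inj₁ e = subst P (sym e) p
... | inj₂ e = subst P (sym e) (largest-closed z ps)

∈⇒≤largest : ∀ {x xs} → x ∈ xs → x ≤ largest xs
∈⇒≤largest {x} {_ ∷ xs} (here refl) = ℕ.m≤m⊔n x (largest xs)
∈⇒≤largest {x} {y ∷ xs} (there p)   = ℕ.≤-trans (∈⇒≤largest p) (ℕ.m≤n⊔m y (largest xs))

largest≤ : ∀ {b xs} → All (_≤ b) xs → largest xs ≤ b
largest≤ []       = z≤n
largest≤ (p ∷ ps) = ℕ.⊔-lub p (largest≤ ps)

countGE-accept : ∀ {j x} π → j ≤ x → countGE j (x ∷ π) ≡ suc (countGE j π)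
countGE-accept {j} π p = cong length (filter-accept (λ y → j ≤? y) {xs = π} p)

countGE-reject : ∀ {j x} π → x < j → countGE j (x ∷ π) ≡ countGE j π
countGE-reject {j} π p = cong length (filter-reject (λ y → j ≤? y) {xs = π} (ℕ.<⇒≱ p))

countGE-antitone : ∀ {i j} π → i ≤ j → countGE j π ≤ countGE i π
countGE-antitone []      p = z≤n
countGE-antitone {i} {j} (x ∷ π) p with j ≤? x | i ≤? x
... | yes q | _ rewrite countGE-accept π q | countGE-accept π (ℕ.≤-trans p q) = s≤s (countGE-antitone π p)
... | no  q | yes r rewrite countGE-reject π (ℕ.≰⇒> q) | countGE-accept π r = ℕ.m≤n⇒m≤1+n (countGE-antitone π p)
... | no  q | no  r rewrite countGE-reject π (ℕ.≰⇒> q) | countGE-reject π (ℕ.≰⇒> r) = countGE-antitone π p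

countGE-above : ∀ {b π} → All (_≤ b) π → countGE (suc b) π ≡ 0
countGE-above {b} parts = cong length (filter-none (λ y → suc b ≤? y) (All.map ℕ.≤⇒≯ parts))

countGE⇒≤largest : ∀ {j} π → 0 < countGE j π → j ≤ largest π
countGE⇒≤largest {j} (x ∷ π) p with j ≤? x
... | yes q = ℕ.≤-trans q (ℕ.m≤m⊔n x (largest π))
... | no  q rewrite countGE-reject π (ℕ.≰⇒> q) = ℕ.≤-trans (countGE⇒≤largest π p) (ℕ.m≤n⊔m x (largest π))

-- Replaces the maximum in `durfee` by two counts, which change by a known amount when a part is
-- prepended.
DurfeeIs : ℕ → List ℕ → Set
DurfeeIs j π = j ≤ countGE j π × countGE (suc j) π ≤ j

durfee-attained : ∀ π → durfee π ≤ countGE (durfee π) π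
durfee-attained π = largest-closed {P = λ j → j ≤ countGE j π} z≤n (All.all-filter (λ j → j ≤? countGE j π) (upTo (suc (length π))))

durfee-greatest : ∀ {j} π → j ≤ countGE j π → j ≤ durfee π
durfee-greatest {j} π p = ∈⇒≤largest (∈-filter⁺ (λ i → i ≤? countGE i π)
  (∈-upTo⁺ (s≤s (ℕ.≤-trans p (length-filter (λ x → j ≤? x) π)))) p)

durfee⇒DurfeeIs : ∀ {j} π → durfee π ≡ j → DurfeeIs j π
durfee⇒DurfeeIs π refl = durfee-attained π , ℕ.≮⇒≥ λ q → ℕ.<-irrefl refl (durfee-greatest π q)

-- `countGE` is antitone in its threshold, so a square larger than j would already give more than j
-- parts ≥ j + 1.
DurfeeIs⇒durfee : ∀ {j} π → DurfeeIs j π → durfee π ≡ j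
DurfeeIs⇒durfee {j} π (p , q) = ℕ.≤-antisym
  (ℕ.≮⇒≥ λ r → ℕ.<-irrefl refl (ℕ.≤-trans r (ℕ.≤-trans (durfee-attained π) (ℕ.≤-trans (countGE-antitone π r) q))))
  (durfee-greatest π p)

-- Σ q^|λ| φ(largest part of λ) over the partitions λ fitting in a d × i box (parts ≤ d, at most i of them)
box : ℕ → ℕ → (ℕ → Series) → Series
box d       zero    φ = φ 0
box zero    (suc i) φ = φ 0
box (suc d) (suc i) φ = box d (suc i) φ + qPow (suc d) * box (suc d) i (λ l → φ (suc d ⊔ l))

box-cong : ∀ d i {φ ψ : ℕ → Series} → (∀ l → φ l ≈ ψ l) → box d i φ ≈ box d i ψ
box-cong d       zero    e = e 0
box-cong zero    (suc i) e = e 0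
box-cong (suc d) (suc i) e = SR.+-cong (box-cong d (suc i) e) (*ˡ (qPow (suc d)) (box-cong (suc d) i (λ l → e (suc d ⊔ l))))

-- The defining recursion removes the largest part; this one removes the first column, i.e. it is
-- the former for the conjugate partition.
box-column : ∀ d i φ → box (suc d) (suc i) φ ≈ (box (suc d) i φ + qPow (suc i) * box d (suc i) (φ ∘ suc))
box-column zero    zero    φ = SR.refl
box-column zero    (suc i) φ = begin
  (φ 0 + qPow 1 * box 1 (suc i) φ₁)
    ≈⟨ +ˡ (φ 0) (*ˡ (qPow 1) (box-column zero i φ₁)) ⟩
  (φ 0 + qPow 1 * (box 1 i φ₁ + qPow (suc i) * φ 1))
    ≈⟨ expand (φ 0) (qPow 1) (box 1 i φ₁) (qPow (suc i)) (φ 1) ⟩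
  (φ 0 + qPow 1 * box 1 i φ₁ + qPow 1 * qPow (suc i) * φ 1)
    ≈⟨ +ˡ (φ 0 + qPow 1 * box 1 i φ₁) (*ʳ (φ 1) (qPow-+ 1 (suc i))) ⟩
  (φ 0 + qPow 1 * box 1 i φ₁ + qPow (suc (suc i)) * φ 1) ∎
  where
  open ≈-Reasoning
  φ₁ : ℕ → Series
  φ₁ l = φ (1 ⊔ l)
  expand : ∀ a b c d e → (a + b * (c + d * e)) ≈ (a + b * c + b * d * e)
  expand = solve 5 (λ a b c d e → a :+ b :* (c :+ d :* e) := a :+ b :* c :+ b :* d :* e) SR.refl
box-column (suc d) zero φ = begin
  (box (suc d) 1 φ + qPow (suc (suc d)) * φ (suc (suc d)))
    ≈⟨ SR.+-cong (box-column d zero φ) (*ʳ (φ (suc (suc d))) (SR.sym (qPow-+ 1 (suc d)))) ⟩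
  ((φ 0 + qPow 1 * box d 1 (φ ∘ suc)) + qPow 1 * qPow (suc d) * φ (suc (suc d)))
    ≈⟨ collect (φ 0) (qPow 1) (box d 1 (φ ∘ suc)) (qPow (suc d)) (φ (suc (suc d))) ⟩
  (φ 0 + qPow 1 * (box d 1 (φ ∘ suc) + qPow (suc d) * φ (suc (suc d)))) ∎
  where
  open ≈-Reasoning
  collect : ∀ a b c d e → ((a + b * c) + b * d * e) ≈ (a + b * (c + d * e))
  collect = solve 5 (λ a b c d e → (a :+ b :* c) :+ b :* d :* e := a :+ b :* (c :+ d :* e)) SR.refl
box-column (suc d) (suc i) φ = begin
  (box (suc d) (suc (suc i)) φ + qPow (suc (suc d)) * box (suc (suc d)) (suc i) φ′)
    ≈⟨ SR.+-cong (box-column d (suc i) φ) (*ˡ (qPow (suc (suc d))) (box-column (suc d) i φ′)) ⟩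
  ((a + qPow (suc (suc i)) * b) + qPow (suc (suc d)) * (c + qPow (suc i) * e))
    ≈⟨ expand a (qPow (suc (suc i))) b (qPow (suc (suc d))) c (qPow (suc i)) e ⟩
  ((a + qPow (suc (suc d)) * c) + (qPow (suc (suc i)) * b + (qPow (suc (suc d)) * qPow (suc i)) * e))
    ≈⟨ +ˡ (a + qPow (suc (suc d)) * c) (+ˡ (qPow (suc (suc i)) * b) (*ʳ e powers)) ⟩
  ((a + qPow (suc (suc d)) * c) + (qPow (suc (suc i)) * b + (qPow (suc (suc i)) * qPow (suc d)) * e))
    ≈⟨ +ˡ (a + qPow (suc (suc d)) * c) (collect (qPow (suc (suc i))) b (qPow (suc d)) e) ⟩
  ((a + qPow (suc (suc d)) * c) + qPow (suc (suc i)) * (b + qPow (suc d) * e)) ∎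
  where
  open ≈-Reasoning
  φ′ : ℕ → Series
  φ′ l = φ (suc (suc d) ⊔ l)
  a = box (suc d) (suc i) φ
  b = box d (suc (suc i)) (φ ∘ suc)
  c = box (suc (suc d)) i φ′
  e = box (suc d) (suc i) (φ′ ∘ suc)
  expand : ∀ a x b y c z e → ((a + x * b) + y * (c + z * e)) ≈ ((a + y * c) + (x * b + (y * z) * e))
  expand = solve 7 (λ a x b y c z e → (a :+ x :* b) :+ y :* (c :+ z :* e) := (a :+ y :* c) :+ (x :* b :+ (y :* z) :* e)) SR.refl
  collect : ∀ x b y e → (x * b + (x * y) * e) ≈ (x * (b + y * e))
  collect = solve 4 (λ x b y e → x :* b :+ (x :* y) :* e := x :* (b :+ y :* e)) SR.refl
  -- A full row followed by a full column removes the same hook as the column followed by the row.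
  exponents : suc (suc d) ℕ.+ suc i ≡ suc (suc i) ℕ.+ suc d
  exponents = cong suc (ℕ.+-comm (suc d) (suc i))
  powers : (qPow (suc (suc d)) * qPow (suc i)) ≈ (qPow (suc (suc i)) * qPow (suc d))
  powers = SR.trans (qPow-+ (suc (suc d)) (suc i)) (SR.trans (SR.reflexive (cong qPow exponents)) (SR.sym (qPow-+ (suc (suc i)) (suc d))))

shift-cong-< : ∀ a {f g : Series} n → (∀ m → m < n → f m ≡ g m) → shift (suc a) f n ≡ shift (suc a) g n
shift-cong-< a       zero    e = refl
shift-cong-< zero    (suc n) e = e n ℕ.≤-refl
shift-cong-< (suc a) (suc n) e = shift-cong-< a n (λ m p → e m (ℕ.m≤n⇒m≤1+n p))

-- This is where conjugation enters: by `box-column` the box obeys the recursion of partitions with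
-- parts ≤ i, its columns being the parts, and the largest row becomes the number of columns.
-- Degrees n ≤ d cannot feel the width.
box-limit : ∀ d i φ n → n ≤ d → box d i φ n ≡ partSeries i (λ σ → φ (length σ)) n
box-limit d zero φ n p = sym (at (partSeries-zero (λ σ → φ (length σ))) n)
box-limit zero (suc i) φ zero z≤n = begin
  φ 0 0                                              ≡⟨ box-zero i ⟩
  box zero i φ 0                                     ≡⟨ box-limit zero i φ 0 z≤n ⟩
  partSeries i (λ σ → φ (length σ)) 0                ≡⟨ sym (ℤ.+-identityʳ _) ⟩
  partSeries i (λ σ → φ (length σ)) 0 ℤ.+ 0ℤ
    ≡⟨ cong (λ s → partSeries i (λ σ → φ (length σ)) 0 ℤ.+ s) (sym (at (qPow-* (suc i) (partSeries (suc i) (λ σ → φ (suc (length σ))))) 0)) ⟩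
  (partSeries i (λ σ → φ (length σ)) + qPow (suc i) * partSeries (suc i) (λ σ → φ (suc (length σ)))) 0
    ≡⟨ sym (at (partSeries-suc i (λ σ → φ (length σ))) 0) ⟩
  partSeries (suc i) (λ σ → φ (length σ)) 0          ∎
  where
  open ≡-Reasoning
  box-zero : ∀ i → φ 0 0 ≡ box zero i φ 0
  box-zero zero    = refl
  box-zero (suc i) = refl
box-limit (suc d) (suc i) φ n p = begin
  box (suc d) (suc i) φ n
    ≡⟨ at (box-column d i φ) n ⟩
  box (suc d) i φ n ℤ.+ (qPow (suc i) * box d (suc i) (φ ∘ suc)) n
    ≡⟨ cong₂ ℤ._+_ (box-limit (suc d) i φ n p) (at (qPow-* (suc i) (box d (suc i) (φ ∘ suc))) n) ⟩
  partSeries i (λ σ → φ (length σ)) n ℤ.+ shift (suc i) (box d (suc i) (φ ∘ suc)) n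
    -- Removing a column lowers the width by one, but the degree drops at least as much, so n ≤ d is
    -- preserved.
    ≡⟨ cong (λ s → partSeries i (λ σ → φ (length σ)) n ℤ.+ s)
         (shift-cong-< i n (λ m q → box-limit d (suc i) (φ ∘ suc) m (ℕ.s≤s⁻¹ (ℕ.≤-trans q p)))) ⟩
  partSeries i (λ σ → φ (length σ)) n ℤ.+ shift (suc i) (partSeries (suc i) (λ σ → φ (suc (length σ)))) n
    ≡⟨ cong (λ s → partSeries i (λ σ → φ (length σ)) n ℤ.+ s) (sym (at (qPow-* (suc i) (partSeries (suc i) (λ σ → φ (suc (length σ))))) n)) ⟩
  (partSeries i (λ σ → φ (length σ)) + qPow (suc i) * partSeries (suc i) (λ σ → φ (suc (length σ)))) n
    ≡⟨ sym (at (partSeries-suc i (λ σ → φ (length σ))) n) ⟩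
  partSeries (suc i) (λ σ → φ (length σ)) n ∎
  where open ≡-Reasoning

-- Partitions with Durfee square of size j, weighted by F (largest part) (number of parts)
module Durfee (j : ℕ) (F : ℕ → ℕ → ℤ) where

  durfee? : ∀ a π → Dec (j ≤ a ℕ.+ countGE j π × a ℕ.+ countGE (suc j) π ≤ j)
  durfee? a π = (j ≤? a ℕ.+ countGE j π) ×-dec (a ℕ.+ countGE (suc j) π ≤? j)

  -- The weight of π preceded by a parts exceeding j, where l is the maximum of j and those parts.
  weight : ℕ → ℕ → List ℕ → ℤ
  weight a l π = if ⌊ durfee? a π ⌋ then F (l ⊔ largest π) (a ℕ.+ length π) else 0ℤ

  -- What remains of `weight` once all parts are ≤ j: the upper Durfee condition then depends on a
  -- alone, and the largest part no longer varies.
  smallWeight : (ℕ → ℤ) → ℕ → List ℕ → ℤ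
  smallWeight f a π = if ⌊ j ≤? a ℕ.+ countGE j π ⌋ then f (a ℕ.+ length π) else 0ℤ

  smallWeight-∷ : ∀ f a π → smallWeight f a (j ∷ π) ≡ smallWeight f (suc a) π
  smallWeight-∷ f a π = if-cong (j ≤? a ℕ.+ countGE j (j ∷ π)) (j ≤? suc a ℕ.+ countGE j π)
    (subst (j ≤_) count) (subst (j ≤_) (sym count)) (λ _ → cong f (ℕ.+-suc a (length π)))
    where
    count : a ℕ.+ countGE j (j ∷ π) ≡ suc a ℕ.+ countGE j π
    count = trans (cong (a ℕ.+_) (countGE-accept π ℕ.≤-refl)) (ℕ.+-suc a (countGE j π))

  -- With a parts already counted and no part above j, i further parts must equal j. Removing them
  -- costs q^(j i) and leaves an arbitrary partition σ with parts ≤ j, for a total of j + #σ parts.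
  smallSum : ∀ f i a → a ℕ.+ i ≡ j → partSum j (smallWeight f a) ≈ (qPow (j ℕ.* i) * partSum j (λ σ → f (j ℕ.+ length σ)))
  smallSum f zero a e = SR.trans (pointwise λ n → ∑-cong (partsLE j n) at-least) (SR.sym (SR.trans
    (*ʳ (partSum j (λ σ → f (j ℕ.+ length σ))) (SR.trans (SR.reflexive (cong qPow (ℕ.*-zeroʳ j))) qPow-zero)) (SR.*-identityˡ (partSum j (λ σ → f (j ℕ.+ length σ))))))
    where
    a≡j : a ≡ j
    a≡j = trans (sym (ℕ.+-identityʳ a)) e
    at-least : ∀ π → smallWeight f a π ≡ f (j ℕ.+ length π)
    at-least π = trans (if-yes (j ≤? a ℕ.+ countGE j π) (ℕ.≤-trans (ℕ.≤-reflexive (sym a≡j)) (ℕ.m≤m+n a _))) (cong (λ c → f (c ℕ.+ length π)) a≡j)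
  smallSum f (suc i) a e = begin
    partSum j (smallWeight f a)
      ≈⟨ remove-part a (subst (a <_) e (ℕ.m<m+n a (s≤s z≤n))) ⟩
    (qPow j * partSum j (smallWeight f (suc a)))
      ≈⟨ *ˡ (qPow j) (smallSum f i (suc a) (trans (sym (ℕ.+-suc a i)) e)) ⟩
    (qPow j * (qPow (j ℕ.* i) * P))
      ≈⟨ SR.sym (SR.*-assoc (qPow j) (qPow (j ℕ.* i)) P) ⟩
    (qPow j * qPow (j ℕ.* i) * P)
      ≈⟨ *ʳ P (SR.trans (qPow-+ j (j ℕ.* i)) (SR.reflexive (cong qPow (sym (ℕ.*-suc j i))))) ⟩
    (qPow (j ℕ.* suc i) * P) ∎
    where
    open ≈-Reasoning
    P = partSum j (λ σ → f (j ℕ.+ length σ))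
    -- Without a part equal to j the count stays at k < j, so the first summand of the recursion
    -- contributes nothing.
    vanish : ∀ k b → suc b ≡ j → k < j → ∀ n → partSum b (smallWeight f k) n ≡ 0ℤ
    vanish k b refl k<j n = trans (partSum-cong b n (λ π parts → if-no (j ≤? k ℕ.+ countGE j π)
      (λ p → ℕ.<⇒≱ k<j (subst (j ≤_) (trans (cong (k ℕ.+_) (countGE-above parts)) (ℕ.+-identityʳ k)) p)))) (∑-zero (partsLE b n))
    remove-part′ : ∀ b → suc b ≡ j → ∀ k → k < j → partSum (suc b) (smallWeight f k) ≈ (qPow (suc b) * partSum (suc b) (smallWeight f (suc k)))
    remove-part′ b refl k k<j = SR.trans (partSum-suc-* b (smallWeight f k))
      (SR.trans (SR.+-cong (pointwise (vanish k b refl k<j)) (*ˡ (qPow (suc b)) (pointwise λ n → ∑-cong (partsLE (suc b) n) (smallWeight-∷ f k))))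
                (SR.+-identityˡ (qPow (suc b) * partSum (suc b) (smallWeight f (suc k)))))
    remove-part : ∀ k → k < j → partSum j (smallWeight f k) ≈ (qPow j * partSum j (smallWeight f (suc k)))
    remove-part k k<j = subst (λ x → partSum x (smallWeight f k) ≈ (qPow x * partSum x (smallWeight f (suc k)))) e′ (remove-part′ (ℕ.pred j) e′ k k<j)
      where
      e′ : suc (ℕ.pred j) ≡ j
      e′ = ℕ.suc-pred j {{ℕ.>-nonZero (ℕ.≤-trans (s≤s z≤n) k<j)}}

  weight-∷ : ∀ a l {x} π → j < x → weight a l (x ∷ π) ≡ weight (suc a) (l ⊔ x) π
  weight-∷ a l {x} π j<x = if-cong (durfee? a (x ∷ π)) (durfee? (suc a) π)
    (λ (p , q) → subst (j ≤_) (count (ℕ.<⇒≤ j<x)) p , subst (_≤ j) (count j<x) q)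
    (λ (p , q) → subst (j ≤_) (sym (count (ℕ.<⇒≤ j<x))) p , subst (_≤ j) (sym (count j<x)) q)
    (λ _ → cong₂ F (sym (ℕ.⊔-assoc l x (largest π))) (ℕ.+-suc a (length π)))
    where
    count : ∀ {k} → k ≤ x → a ℕ.+ countGE k (x ∷ π) ≡ suc a ℕ.+ countGE k π
    count {k} k≤x = trans (cong (a ℕ.+_) (countGE-accept π k≤x)) (ℕ.+-suc a (countGE k π))

  overflow : ∀ b l → partSum b (weight (suc j) l) ≈ zeroS
  overflow b l = pointwise λ n → trans (∑-cong (partsLE b n) (λ π → if-no (durfee? (suc j) π)
    (λ (_ , q) → ℕ.<⇒≱ (s≤s (ℕ.m≤m+n j _)) q))) (∑-zero (partsLE b n))

  -- The sum over what lies below the square; `l′` is the largest part of what lies to its right,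
  -- and `l` the maximum accumulated so far.
  column : ℕ → ℕ → Series
  column l l′ = partSum j (λ σ → F (l ⊔ (j ℕ.+ l′)) (j ℕ.+ length σ))

  -- A part above j is a row of the square together with a row of the box to its right. The i rows
  -- of the square still missing weigh q^(j i) in any case, whether they are extended into the box
  -- or are parts equal to j.
  durfeeSum : ∀ d i a l → a ℕ.+ i ≡ j → j ≤ l →
    partSum (d ℕ.+ j) (weight a l) ≈ (qPow (j ℕ.* i) * box d i (column l))
  durfeeSum zero i a l e j≤l = SR.trans
    (pointwise λ n → partSum-cong j n small)
    (SR.trans (smallSum (F l) i a e) (*ˡ (qPow (j ℕ.* i)) (SR.trans (pointwise λ n → ∑-cong (partsLE j n) (λ σ → cong (λ k → F k (j ℕ.+ length σ)) (sym l⊔j))) (box-zero i))))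
    where
    l⊔j : l ⊔ (j ℕ.+ 0) ≡ l
    l⊔j = trans (cong (l ⊔_) (ℕ.+-identityʳ j)) (ℕ.m≥n⇒m⊔n≡m j≤l)
    box-zero : ∀ i → column l 0 ≈ box zero i (column l)
    box-zero zero    = SR.refl
    box-zero (suc i) = SR.refl
    small : ∀ π → All (_≤ j) π → weight a l π ≡ smallWeight (F l) a π
    small π parts = if-cong (durfee? a π) (j ≤? a ℕ.+ countGE j π) proj₁
      (λ p → p , subst (_≤ j) (sym (trans (cong (a ℕ.+_) (countGE-above parts)) (ℕ.+-identityʳ a))) (subst (a ≤_) e (ℕ.m≤m+n a i)))
      (λ _ → cong (λ k → F k (a ℕ.+ length π)) (ℕ.m≥n⇒m⊔n≡m (ℕ.≤-trans (largest≤ parts) j≤l)))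
  durfeeSum (suc d) i a l e j≤l = SR.trans (partSum-suc-* (d ℕ.+ j) (weight a l))
    (SR.trans (SR.+-cong (durfeeSum d i a l e j≤l)
                         (*ˡ (qPow x) (pointwise λ n → ∑-cong (partsLE x n) (λ π → weight-∷ a l π (s≤s (ℕ.m≤n+m j d))))))
              (split i e))
    where
    open ≈-Reasoning
    x = suc (d ℕ.+ j)
    split : ∀ i → a ℕ.+ i ≡ j →
      (qPow (j ℕ.* i) * box d i (column l) + qPow x * partSum x (weight (suc a) (l ⊔ x))) ≈ (qPow (j ℕ.* i) * box (suc d) i (column l))
    -- The square is complete, so one more part above j would violate the upper Durfee condition.
    split zero e = begin
      (qPow (j ℕ.* 0) * box d 0 (column l) + qPow x * partSum x (weight (suc a) (l ⊔ x)))
        ≈⟨ +ˡ (qPow (j ℕ.* 0) * box d 0 (column l)) (*ˡ (qPow x)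
             (SR.trans (SR.reflexive (cong (λ k → partSum x (weight (suc k) (l ⊔ x))) (trans (sym (ℕ.+-identityʳ a)) e))) (overflow x (l ⊔ x)))) ⟩
      (qPow (j ℕ.* 0) * box d 0 (column l) + qPow x * zeroS)
        ≈⟨ drop (qPow (j ℕ.* 0) * box d 0 (column l)) (qPow x) ⟩
      (qPow (j ℕ.* 0) * box d 0 (column l)) ∎
      where
      drop : ∀ a b → (a + b * zeroS) ≈ a
      drop = solve 2 (λ a b → a :+ b :* con 0ℤ := a) SR.refl
    split (suc i) e = begin
      (qPow (j ℕ.* suc i) * X + qPow x * partSum x (weight (suc a) (l ⊔ x)))
        ≈⟨ SR.+-cong (*ʳ X power₁) (SR.*-cong power₂ (durfeeSum (suc d) i (suc a) (l ⊔ x) (trans (sym (ℕ.+-suc a i)) e) (ℕ.≤-trans j≤l (ℕ.m≤m⊔n l x)))) ⟩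
      (qPow j * qPow (j ℕ.* i) * X + qPow (suc d) * qPow j * (qPow (j ℕ.* i) * box (suc d) i (column (l ⊔ x))))
        ≈⟨ +ˡ (qPow j * qPow (j ℕ.* i) * X) (*ˡ (qPow (suc d) * qPow j) (*ˡ (qPow (j ℕ.* i)) (box-cong (suc d) i absorb))) ⟩
      (qPow j * qPow (j ℕ.* i) * X + qPow (suc d) * qPow j * (qPow (j ℕ.* i) * Y))
        ≈⟨ collect (qPow j) (qPow (j ℕ.* i)) X (qPow (suc d)) Y ⟩
      (qPow j * qPow (j ℕ.* i) * (X + qPow (suc d) * Y))
        ≈⟨ *ʳ (X + qPow (suc d) * Y) (SR.sym power₁) ⟩
      (qPow (j ℕ.* suc i) * (X + qPow (suc d) * Y)) ∎
      where
      X = box d (suc i) (column l)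
      Y = box (suc d) i (λ l′ → column l (suc d ⊔ l′))
      power₁ : qPow (j ℕ.* suc i) ≈ (qPow j * qPow (j ℕ.* i))
      power₁ = SR.trans (SR.reflexive (cong qPow (ℕ.*-suc j i))) (SR.sym (qPow-+ j (j ℕ.* i)))
      power₂ : qPow x ≈ (qPow (suc d) * qPow j)
      power₂ = SR.sym (qPow-+ (suc d) j)
      absorb-⊔ : ∀ l′ → (l ⊔ x) ⊔ (j ℕ.+ l′) ≡ l ⊔ (j ℕ.+ (suc d ⊔ l′))
      absorb-⊔ l′ = trans (ℕ.⊔-assoc l x (j ℕ.+ l′)) (cong (l ⊔_) (trans (cong (_⊔ (j ℕ.+ l′)) (ℕ.+-comm (suc d) j)) (sym (ℕ.+-distribˡ-⊔ j (suc d) l′))))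
      absorb : ∀ l′ → column (l ⊔ x) l′ ≈ column l (suc d ⊔ l′)
      absorb l′ = pointwise λ n → ∑-cong (partsLE j n) (λ σ → cong (λ k → F k (j ℕ.+ length σ)) (absorb-⊔ l′))
      collect : ∀ a b X c Y → (a * b * X + c * a * (b * Y)) ≈ (a * b * (X + c * Y))
      collect = solve 5 (λ a b X c Y → a :* b :* X :+ c :* a :* (b :* Y) := a :* b :* (X :+ c :* Y)) SR.refl

-- The rank series for a fixed Durfee square

rankSum : ℕ → (ℤ → ℤ) → Series
rankSum j f n = ∑ (partitions n) (λ π → if ⌊ durfee π ≟ j ⌋ then f (rank π) else 0ℤ)

-- Below the Durfee square lies τ, to its right the conjugate of σ; the rank is then #σ − #τ.
rankSum-crankSum : ∀ j f → rankSum j f ≈ (qPow (j ℕ.* j) * crankSum j j f)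
rankSum-crankSum j f = SR.trans (pointwise λ n → begin
  rankSum j f n
    ≡⟨ ∑-cong (partitions n) durfee-weight ⟩
  partSum n (weight 0 j) n
    -- The bound on the parts is raised from n to n + j, so that the box to the right of the square
    -- has width n and `box-limit` applies to every coefficient involved.
    ≡⟨ sym (partSum-stable j (weight 0 j) ℕ.≤-refl) ⟩
  partSum (j ℕ.+ n) (weight 0 j) n
    ≡⟨ cong (λ b → partSum b (weight 0 j) n) (ℕ.+-comm j n) ⟩
  partSum (n ℕ.+ j) (weight 0 j) n
    ≡⟨ at (durfeeSum n j 0 j refl ℕ.≤-refl) n ⟩
  (qPow (j ℕ.* j) * box n j (column j)) n
    ≡⟨ at (qPow-* (j ℕ.* j) (box n j (column j))) n ⟩
  shift (j ℕ.* j) (box n j (column j)) n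
    ≡⟨ limit n ⟩
  shift (j ℕ.* j) (crankSum j j f) n ∎) (SR.sym (qPow-* (j ℕ.* j) (crankSum j j f)))
  where
  open ≡-Reasoning
  open Durfee j (λ l c → f (+ l ℤ.- + c))
  durfee-weight : ∀ π → (if ⌊ durfee π ≟ j ⌋ then f (rank π) else 0ℤ) ≡ weight 0 j π
  durfee-weight π = if-cong (durfee π ≟ j) (durfee? 0 π) (durfee⇒DurfeeIs π) (DurfeeIs⇒durfee π)
    (λ e → cong (λ l → f (+ l ℤ.- + length π)) (sym (ℕ.m≤n⇒m⊔n≡n (j≤largest j (proj₁ (durfee⇒DurfeeIs π e))))))
    where
    j≤largest : ∀ j → j ≤ countGE j π → j ≤ largest π
    j≤largest zero    p = z≤n
    j≤largest (suc j) p = countGE⇒≤largest π (ℕ.≤-trans (s≤s z≤n) p)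
  cancel : ∀ j a b → (j ℤ.+ a) ℤ.- (j ℤ.+ b) ≡ a ℤ.- b
  cancel = solve-∀
  column-crank : ∀ σ → column j (length σ) ≈ partSum j (λ τ → f (crank σ τ))
  column-crank σ = pointwise λ n → ∑-cong (partsLE j n) (λ τ → cong f
    (trans (cong (λ l → + l ℤ.- + (j ℕ.+ length τ)) (ℕ.m≤n⇒m⊔n≡n (ℕ.m≤m+n j (length σ)))) (cancel (+ j) (+ length σ) (+ length τ))))
  limit : ∀ n → shift (j ℕ.* j) (box n j (column j)) n ≡ shift (j ℕ.* j) (crankSum j j f) n
  limit n with j ℕ.* j ≤? n
  ... | no ¬p = trans (shift-< (box n j (column j)) (ℕ.≰⇒> ¬p)) (sym (shift-< (crankSum j j f) (ℕ.≰⇒> ¬p)))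
  ... | yes p = begin
    shift (j ℕ.* j) (box n j (column j)) n
      ≡⟨ shift-≥ (box n j (column j)) p ⟩
    box n j (column j) (n ∸ j ℕ.* j)
      ≡⟨ box-limit n j (column j) (n ∸ j ℕ.* j) (ℕ.m∸n≤m n (j ℕ.* j)) ⟩
    partSeries j (λ σ → column j (length σ)) (n ∸ j ℕ.* j)
      ≡⟨ at (partSeries-cong j column-crank) (n ∸ j ℕ.* j) ⟩
    crankSum j j f (n ∸ j ℕ.* j)
      ≡⟨ sym (shift-≥ (crankSum j j f) p) ⟩
    shift (j ℕ.* j) (crankSum j j f) n ∎

-- Partitions into distinct parts

∑-neg : ∀ (xs : List A) (f : A → ℤ) → ∑ xs (λ x → ℤ.- f x) ≡ ℤ.- ∑ xs f
∑-neg []       f = refl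
∑-neg (x ∷ xs) f = trans (cong (λ s → ℤ.- f x ℤ.+ s) (∑-neg xs f)) (sym (ℤ.neg-distrib-+ (f x) (∑ xs f)))

signSum : List ℕ → Series
signSum L n = ∑ (distinctIn L n) sign

signSum-[] : signSum [] ≈ oneS
signSum-[] = pointwise λ { zero → refl ; (suc n) → refl }

signSum-∷ : ∀ a as → signSum (a ∷ as) ≈ (oneMinusQ a * signSum as)
signSum-∷ a as = SR.trans (pointwise λ n → trans (∑-++ (distinctIn as n) _ sign) (cong (λ s → signSum as n ℤ.+ s) (used n)))
  (SR.trans (-ˡ (signSum as) (SR.sym (qPow-* a (signSum as)))) (SR.sym (expand (qPow a) (signSum as))))
  where
  expand : ∀ q s → ((oneS - q) * s) ≈ (s - q * s)
  expand = solve 2 (λ q s → (con 1ℤ :- q) :* s := s :- q :* s) SR.refl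
  used : ∀ n → ∑ (if ⌊ a ≤? n ⌋ then map (a ∷_) (distinctIn as (n ∸ a)) else []) sign ≡ ℤ.- shift a (signSum as) n
  used n with a ≤? n
  ... | yes p = trans (∑-map (a ∷_) (distinctIn as (n ∸ a)) sign) (trans (∑-neg (distinctIn as (n ∸ a)) sign) (cong ℤ.-_ (sym (shift-≥ (signSum as) p))))
  ... | no ¬p = cong ℤ.-_ (sym (shift-< (signSum as) (ℕ.≰⇒> ¬p)))

-- The product (q^(d+1); q)_j = (q)_(d+j) / (q)_d, the signed generating function of distinct parts
-- in [d + 1, d + j].
pochFrom : ℕ → ℕ → Series
pochFrom d zero    = oneS
pochFrom d (suc j) = oneMinusQ (suc d ℕ.+ j) * pochFrom d j

pochFrom-first : ∀ d j → pochFrom d (suc j) ≈ (oneMinusQ (suc d) * pochFrom (suc d) j)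
pochFrom-first d zero    = *ʳ oneS (SR.reflexive (cong oneMinusQ (ℕ.+-identityʳ (suc d))))
pochFrom-first d (suc j) = SR.trans (SR.*-cong (SR.reflexive (cong oneMinusQ (ℕ.+-suc (suc d) j))) (pochFrom-first d j))
  (exchange (oneMinusQ (suc (suc d) ℕ.+ j)) (oneMinusQ (suc d)) (pochFrom (suc d) j))
  where
  exchange : ∀ x y z → (x * (y * z)) ≈ (y * (x * z))
  exchange = solve 3 (λ x y z → x :* (y :* z) := y :* (x :* z)) SR.refl

signSum-decRange : ∀ d j → signSum (decRange (suc d) (d ℕ.+ j)) ≈ pochFrom d j
signSum-decRange d j = SR.trans (SR.reflexive (cong signSum parts)) (go j)
  where
  open ≡-Reasoning
  parts : decRange (suc d) (d ℕ.+ j) ≡ map (suc d ℕ.+_) (downFrom j)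
  parts = begin
    reverse (map (suc d ℕ.+_) (upTo (d ℕ.+ j ∸ d)))   ≡⟨ cong (λ k → reverse (map (suc d ℕ.+_) (upTo k))) (ℕ.m+n∸m≡n d j) ⟩
    reverse (map (suc d ℕ.+_) (upTo j))               ≡⟨ sym (reverse-map (suc d ℕ.+_) (upTo j)) ⟩
    map (suc d ℕ.+_) (reverse (upTo j))               ≡⟨ cong (map (suc d ℕ.+_)) (reverse-upTo j) ⟩
    map (suc d ℕ.+_) (downFrom j)                     ∎
  go : ∀ j → signSum (map (suc d ℕ.+_) (downFrom j)) ≈ pochFrom d j
  go zero    = signSum-[]
  go (suc j) = SR.trans (signSum-∷ (suc d ℕ.+ j) (map (suc d ℕ.+_) (downFrom j))) (*ˡ (oneMinusQ (suc d ℕ.+ j)) (go j))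

-- Moments

∑-pick : ∀ (x : ℕ → ℤ) i M → i < M → ∑ (upTo M) (λ t → if ⌊ t ≟ i ⌋ then x t else 0ℤ) ≡ x i
∑-pick x zero (suc M) p = trans (∑-upTo-suc (λ t → if ⌊ t ≟ 0 ⌋ then x t else 0ℤ) M)
  (trans (cong (λ s → x 0 ℤ.+ s) (trans (∑-cong (upTo M) (λ t → if-no (suc t ≟ 0) {x (suc t)} {0ℤ} (λ ()))) (∑-zero (upTo M)))) (ℤ.+-identityʳ (x 0)))
∑-pick x (suc i) (suc M) (s≤s p) = trans (∑-upTo-suc (λ t → if ⌊ t ≟ suc i ⌋ then x t else 0ℤ) M)
  (trans (ℤ.+-identityˡ _) (trans (∑-cong (upTo M) (λ t → if-⇔ (suc t ≟ suc i) (t ≟ i) ℕ.suc-injective (cong suc))) (∑-pick (x ∘ suc) i M p)))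

-- A difference a - b with a, b ≤ n lies in [-n, n] and stands at position a + (n - b) of
-- `symRange n`. So the finite range of m loses no rank or crank, and the sum over m collapses to
-- one value of `f`.
∑-symRange : ∀ (f : ℤ → ℤ) s {a b n} → a ≤ n → b ≤ n →
  ∑ (symRange n) (λ m → f m ℤ.* (if ⌊ (+ a ℤ.- + b) ℤ.≟ m ⌋ then s else 0ℤ)) ≡ s ℤ.* f (+ a ℤ.- + b)
∑-symRange f s {a} {b} {n} a≤n b≤n = begin
  ∑ (symRange n) (λ m → f m ℤ.* (if ⌊ c ℤ.≟ m ⌋ then s else 0ℤ))
    ≡⟨ ∑-map (λ i → + i ℤ.- + n) (upTo (suc (2 ℕ.* n))) (λ m → f m ℤ.* (if ⌊ c ℤ.≟ m ⌋ then s else 0ℤ)) ⟩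
  ∑ (upTo (suc (2 ℕ.* n))) (λ i → f (+ i ℤ.- + n) ℤ.* (if ⌊ c ℤ.≟ + i ℤ.- + n ⌋ then s else 0ℤ))
    ≡⟨ ∑-cong (upTo (suc (2 ℕ.* n))) pull ⟩
  ∑ (upTo (suc (2 ℕ.* n))) (λ i → if ⌊ i ≟ i₀ ⌋ then s ℤ.* f (+ i ℤ.- + n) else 0ℤ)
    ≡⟨ ∑-pick (λ i → s ℤ.* f (+ i ℤ.- + n)) i₀ (suc (2 ℕ.* n)) (s≤s (ℕ.+-mono-≤ a≤n (ℕ.≤-trans (ℕ.m∸n≤m n b) (ℕ.m≤m+n n 0)))) ⟩
  s ℤ.* f (+ i₀ ℤ.- + n)
    ≡⟨ cong (λ z → s ℤ.* f z) centre ⟩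
  s ℤ.* f c ∎
  where
  open ≡-Reasoning
  c = + a ℤ.- + b
  i₀ = a ℕ.+ (n ∸ b)
  cancel : ∀ a b e → (a ℤ.+ e) ℤ.- (b ℤ.+ e) ≡ a ℤ.- b
  cancel = solve-∀
  centre : + i₀ ℤ.- + n ≡ c
  centre = trans (cong (λ k → + i₀ ℤ.- + k) (sym (ℕ.m+[n∸m]≡n b≤n))) (cancel (+ a) (+ b) (+ (n ∸ b)))
  add-back : ∀ x y → x ≡ (x ℤ.- y) ℤ.+ y
  add-back = solve-∀
  injective : ∀ i → c ≡ + i ℤ.- + n → i ≡ i₀
  injective i e = ℤ.+-injective (trans (add-back (+ i) (+ n)) (trans (cong (ℤ._+ + n) (trans (sym e) (sym centre))) (sym (add-back (+ i₀) (+ n)))))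
  pull : ∀ i → f (+ i ℤ.- + n) ℤ.* (if ⌊ c ℤ.≟ + i ℤ.- + n ⌋ then s else 0ℤ) ≡ (if ⌊ i ≟ i₀ ⌋ then s ℤ.* f (+ i ℤ.- + n) else 0ℤ)
  pull i with c ℤ.≟ + i ℤ.- + n
  ... | yes e = trans (ℤ.*-comm (f (+ i ℤ.- + n)) s) (sym (if-yes (i ≟ i₀) (injective i e)))
  ... | no ¬e = trans (ℤ.*-zeroʳ (f (+ i ℤ.- + n))) (sym (if-no (i ≟ i₀) (λ { refl → ¬e (sym centre) })))

∑-moment : ∀ (ms : List B) (xs : List A) (f : B → ℤ) (h : B → A → ℤ) →
  ∑ ms (λ m → f m ℤ.* ∑ xs (h m)) ≡ ∑ xs (λ x → ∑ ms (λ m → f m ℤ.* h m x))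
∑-moment ms xs f h = trans (∑-cong ms (λ m → sym (∑-*ˡ xs (f m) (h m)))) (∑-swap ms xs (λ m x → f m ℤ.* h m x))

∑-product : ∀ (xs : List A) (ys : List B) (f : A → ℤ) (g : B → ℤ) → ∑ xs (λ x → ∑ ys (λ y → f x ℤ.* g y)) ≡ ∑ xs f ℤ.* ∑ ys g
∑-product xs ys f g = trans (∑-cong xs (λ x → ∑-*ˡ ys (f x) g)) (∑-*ʳ xs f (∑ ys g))

length≤sum : ∀ {b π} → All (λ x → 1 ≤ x × x ≤ b) π → length π ≤ sum π
length≤sum []              = z≤n
length≤sum ((p , _) ∷ ps)  = ℕ.+-mono-≤ p (length≤sum ps)

largest≤sum : ∀ π → largest π ≤ sum π
largest≤sum []      = z≤n
largest≤sum (x ∷ π) = ℕ.⊔-lub (ℕ.m≤m+n x (sum π)) (ℕ.≤-trans (largest≤sum π) (ℕ.m≤n+m (sum π) x))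

length≤ : ∀ {b n m π} → m ≤ n → PartitionLE b m π → length π ≤ n
length≤ m≤n (parts , e) = ℕ.≤-trans (length≤sum parts) (ℕ.≤-trans (ℕ.≤-reflexive e) m≤n)

largest≤weight : ∀ {b n m π} → m ≤ n → PartitionLE b m π → largest π ≤ n
largest≤weight {π = π} m≤n (_ , e) = ℕ.≤-trans (largest≤sum π) (ℕ.≤-trans (ℕ.≤-reflexive e) m≤n)

-- The sum over m is moved inward until it meets a single pair of partitions, where `∑-symRange`
-- evaluates it: largest part and number of parts are both at most n.
η-series : ∀ k N n →
  η k N n ≡ ∑ (range 1 N) (λ j → (signSum (decRange (suc N ∸ j) N) * rankSum j (momentWeight k)) n)
η-series k N n = begin
  ∑ ms (λ m → f m ℤ.* NS1 N m n)
    ≡⟨ ∑-moment ms (range 1 N) f _ ⟩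
  ∑ (range 1 N) (λ j → ∑ ms (λ m → f m ℤ.* ∑ (upTo (suc n)) (λ a → ∑ (D j a) (λ π₁ → ∑ (partitions (n ∸ a)) (term j m π₁)))))
    ≡⟨ ∑-cong (range 1 N) (λ j → ∑-moment ms (upTo (suc n)) f _) ⟩
  ∑ (range 1 N) (λ j → ∑ (upTo (suc n)) (λ a → ∑ ms (λ m → f m ℤ.* ∑ (D j a) (λ π₁ → ∑ (partitions (n ∸ a)) (term j m π₁)))))
    ≡⟨ ∑-cong (range 1 N) (λ j → ∑-cong (upTo (suc n)) (λ a → fixed j a)) ⟩
  ∑ (range 1 N) (λ j → (signSum (decRange (suc N ∸ j) N) * rankSum j f) n) ∎
  where
  open ≡-Reasoning
  ms = symRange n
  f = momentWeight k
  D : ℕ → ℕ → List (List ℕ)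
  D j = distinctIn (decRange (suc N ∸ j) N)
  term : ℕ → ℤ → List ℕ → List ℕ → ℤ
  term j m π₁ π₂ = if ⌊ (durfee π₂ ≟ j) ×-dec (rank π₂ ℤ.≟ m) ⌋ then sign π₁ else 0ℤ
  value : ℕ → List ℕ → ℤ
  value j π₂ = if ⌊ durfee π₂ ≟ j ⌋ then f (rank π₂) else 0ℤ
  pick : ∀ j π₁ {b m} π₂ → m ≤ n → PartitionLE b m π₂ → ∑ ms (λ m → f m ℤ.* term j m π₁ π₂) ≡ sign π₁ ℤ.* value j π₂
  pick j π₁ π₂ m≤n valid = by-cases (durfee π₂ ≟ j)
    where
    by-cases : Dec (durfee π₂ ≡ j) → ∑ ms (λ m → f m ℤ.* term j m π₁ π₂) ≡ sign π₁ ℤ.* value j π₂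
    by-cases (yes e) = trans
      (∑-cong ms (λ m → cong (f m ℤ.*_) (if-⇔ ((durfee π₂ ≟ j) ×-dec (rank π₂ ℤ.≟ m)) (rank π₂ ℤ.≟ m) proj₂ (e ,_))))
      (trans (∑-symRange f (sign π₁) (largest≤weight m≤n valid) (length≤ m≤n valid)) (cong (sign π₁ ℤ.*_) (sym (if-yes (durfee π₂ ≟ j) e))))
    by-cases (no ¬e) = trans
      (∑-cong ms (λ m → trans (cong (f m ℤ.*_) (if-no ((durfee π₂ ≟ j) ×-dec (rank π₂ ℤ.≟ m)) (¬e ∘ proj₁))) (ℤ.*-zeroʳ (f m))))
      (trans (∑-zero ms) (trans (sym (ℤ.*-zeroʳ (sign π₁))) (cong (sign π₁ ℤ.*_) (sym (if-no (durfee π₂ ≟ j) ¬e)))))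
  fixed : ∀ j a → ∑ ms (λ m → f m ℤ.* ∑ (D j a) (λ π₁ → ∑ (partitions (n ∸ a)) (term j m π₁))) ≡ signSum (decRange (suc N ∸ j) N) a ℤ.* rankSum j f (n ∸ a)
  fixed j a = begin
    ∑ ms (λ m → f m ℤ.* ∑ (D j a) (λ π₁ → ∑ (partitions (n ∸ a)) (term j m π₁)))
      ≡⟨ ∑-moment ms (D j a) f _ ⟩
    ∑ (D j a) (λ π₁ → ∑ ms (λ m → f m ℤ.* ∑ (partitions (n ∸ a)) (term j m π₁)))
      ≡⟨ ∑-cong (D j a) (λ π₁ → ∑-moment ms (partitions (n ∸ a)) f _) ⟩
    ∑ (D j a) (λ π₁ → ∑ (partitions (n ∸ a)) (λ π₂ → ∑ ms (λ m → f m ℤ.* term j m π₁ π₂)))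
      ≡⟨ ∑-cong (D j a) (λ π₁ → ∑-cong-All (All.map (λ {π₂} → pick j π₁ π₂ (ℕ.m∸n≤m n a)) (partsLE-valid (n ∸ a) (n ∸ a)))) ⟩
    ∑ (D j a) (λ π₁ → ∑ (partitions (n ∸ a)) (λ π₂ → sign π₁ ℤ.* value j π₂))
      ≡⟨ ∑-product (D j a) (partitions (n ∸ a)) sign (value j) ⟩
    signSum (decRange (suc N ∸ j) N) a ℤ.* rankSum j f (n ∸ a) ∎

μ-series : ∀ k N n → μ k N n ≡ (signSum (decRange 1 N) * crankSum N N (momentWeight k)) n
μ-series k N n = begin
  ∑ ms (λ m → f m ℤ.* MS2 N m n)
    ≡⟨ ∑-moment ms (upTo (suc n)) f _ ⟩
  ∑ (upTo (suc n)) (λ a → ∑ ms (λ m → f m ℤ.* ∑ (upTo (suc (n ∸ a))) (inner m a)))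
    ≡⟨ ∑-cong (upTo (suc n)) (λ a → trans (∑-moment ms (upTo (suc (n ∸ a))) f (λ m → inner m a)) (fixed a)) ⟩
  (signSum (decRange 1 N) * crankSum N N f) n ∎
  where
  open ≡-Reasoning
  ms = symRange n
  f = momentWeight k
  D : ℕ → List (List ℕ)
  D = distinctIn (decRange 1 N)
  term : ℤ → List ℕ → List ℕ → List ℕ → ℤ
  term m π₁ π₂ π₃ = if ⌊ crank π₂ π₃ ℤ.≟ m ⌋ then sign π₁ else 0ℤ
  inner : ℤ → ℕ → ℕ → ℤ
  inner m a b = ∑ (D a) (λ π₁ → ∑ (partsLE N b) (λ π₂ → ∑ (partsLE N (n ∸ a ∸ b)) (term m π₁ π₂)))
  pairs : ℕ → ℕ → ℤ
  pairs b c = ∑ (partsLE N b) (λ π₂ → ∑ (partsLE N c) (λ π₃ → f (crank π₂ π₃)))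
  fixed₂ : ∀ a b → b ≤ n → ∑ ms (λ m → f m ℤ.* inner m a b) ≡ signSum (decRange 1 N) a ℤ.* pairs b (n ∸ a ∸ b)
  fixed₂ a b b≤n = begin
    ∑ ms (λ m → f m ℤ.* inner m a b)
      ≡⟨ ∑-moment ms (D a) f _ ⟩
    ∑ (D a) (λ π₁ → ∑ ms (λ m → f m ℤ.* ∑ (partsLE N b) (λ π₂ → ∑ (partsLE N c) (term m π₁ π₂))))
      ≡⟨ ∑-cong (D a) (λ π₁ → trans (∑-moment ms (partsLE N b) f _) (∑-cong (partsLE N b) (λ π₂ → ∑-moment ms (partsLE N c) f _))) ⟩
    ∑ (D a) (λ π₁ → ∑ (partsLE N b) (λ π₂ → ∑ (partsLE N c) (λ π₃ → ∑ ms (λ m → f m ℤ.* term m π₁ π₂ π₃))))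
      ≡⟨ ∑-cong (D a) (λ π₁ → ∑-cong-All (All.map (λ {π₂} v₂ → ∑-cong-All (All.map (λ {π₃} v₃ →
           ∑-symRange f (sign π₁) (length≤ b≤n v₂) (length≤ (ℕ.≤-trans (ℕ.m∸n≤m (n ∸ a) b) (ℕ.m∸n≤m n a)) v₃))
           (partsLE-valid N c))) (partsLE-valid N b))) ⟩
    ∑ (D a) (λ π₁ → ∑ (partsLE N b) (λ π₂ → ∑ (partsLE N c) (λ π₃ → sign π₁ ℤ.* f (crank π₂ π₃))))
      ≡⟨ ∑-cong (D a) (λ π₁ → ∑-cong (partsLE N b) (λ π₂ → ∑-*ˡ (partsLE N c) (sign π₁) (λ π₃ → f (crank π₂ π₃)))) ⟩
    ∑ (D a) (λ π₁ → ∑ (partsLE N b) (λ π₂ → sign π₁ ℤ.* ∑ (partsLE N c) (λ π₃ → f (crank π₂ π₃))))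
      ≡⟨ ∑-product (D a) (partsLE N b) sign (λ π₂ → ∑ (partsLE N c) (λ π₃ → f (crank π₂ π₃))) ⟩
    signSum (decRange 1 N) a ℤ.* pairs b c ∎
    where c = n ∸ a ∸ b
  fixed : ∀ a → ∑ (upTo (suc (n ∸ a))) (λ b → ∑ ms (λ m → f m ℤ.* inner m a b)) ≡ signSum (decRange 1 N) a ℤ.* crankSum N N f (n ∸ a)
  fixed a = begin
    ∑ (upTo (suc (n ∸ a))) (λ b → ∑ ms (λ m → f m ℤ.* inner m a b))
      -- Membership in the list gives b ≤ n - a, which bounds the number of parts of the second
      -- partition by n.
      ≡⟨ ∑-cong-All (All.tabulate (λ {b} b∈ → fixed₂ a b (ℕ.≤-trans (ℕ.s≤s⁻¹ (∈-upTo⁻ b∈)) (ℕ.m∸n≤m n a)))) ⟩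
    ∑ (upTo (suc (n ∸ a))) (λ b → signSum (decRange 1 N) a ℤ.* pairs b (n ∸ a ∸ b))
      ≡⟨ ∑-*ˡ (upTo (suc (n ∸ a))) (signSum (decRange 1 N) a) (λ b → pairs b (n ∸ a ∸ b)) ⟩
    signSum (decRange 1 N) a ℤ.* ∑ (upTo (suc (n ∸ a))) (λ b → pairs b (n ∸ a ∸ b))
      ≡⟨ cong (signSum (decRange 1 N) a ℤ.*_) (∑-conv pairs (n ∸ a)) ⟩
    signSum (decRange 1 N) a ℤ.* crankSum N N f (n ∸ a) ∎

-- A sequence X stands for Σ X k · y^k, where y = z + 1/z − 2.

byY : (ℕ → Series) → ℕ → Series
byY X zero    = zeroS
byY X (suc k) = X k

byY-cong : ∀ {X Y} → (∀ k → X k ≈ Y k) → ∀ k → byY X k ≈ byY Y k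
byY-cong e zero    = SR.refl
byY-cong e (suc k) = e k

byY-+ : ∀ X Y k → byY (λ k → X k + Y k) k ≈ (byY X k + byY Y k)
byY-+ X Y zero    = SR.sym (SR.+-identityˡ zeroS)
byY-+ X Y (suc k) = SR.refl

byY-* : ∀ P X k → byY (λ k → P * X k) k ≈ (P * byY X k)
byY-* P X zero    = SR.sym (SR.zeroʳ P)
byY-* P X (suc k) = SR.refl

-- Multiplication by (1 − z q^i)(1 − q^i/z) = (1 − q^i)² − q^i y.
byD : ℕ → (ℕ → Series) → ℕ → Series
byD i X k = oneMinusQ i * oneMinusQ i * X k - qPow i * byY X k

byD-cong : ∀ i {X Y} → (∀ k → X k ≈ Y k) → ∀ k → byD i X k ≈ byD i Y k
byD-cong i e k = SR.+-cong (*ˡ (oneMinusQ i * oneMinusQ i) (e k)) (SR.-‿cong (*ˡ (qPow i) (byY-cong e k)))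

byD-+ : ∀ i X Y k → byD i (λ k → X k + Y k) k ≈ (byD i X k + byD i Y k)
byD-+ i X Y k = SR.trans (-ˡ (p * (X k + Y k)) (*ˡ (qPow i) (byY-+ X Y k))) (distribute p (X k) (Y k) (qPow i) (byY X k) (byY Y k))
  where
  p = oneMinusQ i * oneMinusQ i
  distribute : ∀ p x y q u v → (p * (x + y) - q * (u + v)) ≈ ((p * x - q * u) + (p * y - q * v))
  distribute = solve 6 (λ p x y q u v → p :* (x :+ y) :- q :* (u :+ v) := (p :* x :- q :* u) :+ (p :* y :- q :* v)) SR.refl

byD-* : ∀ i P X k → byD i (λ k → P * X k) k ≈ (P * byD i X k)
byD-* i P X k = SR.trans (-ˡ (p * (P * X k)) (*ˡ (qPow i) (byY-* P X k))) (factor p P (X k) (qPow i) (byY X k))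
  where
  p = oneMinusQ i * oneMinusQ i
  factor : ∀ p P x q u → (p * (P * x) - q * (P * u)) ≈ (P * (p * x - q * u))
  factor = solve 5 (λ p P x q u → p :* (P :* x) :- q :* (P :* u) := P :* (p :* x :- q :* u)) SR.refl

-- The coefficient of y^0 in D is (1 - q^(n+1))², a unit; hence X k is determined by the k-th entry
-- of the product and by X (k - 1), and induction on k applies.
byD-injective : ∀ n {X Y : ℕ → Series} → (∀ k → byD (suc n) X k ≈ byD (suc n) Y k) → ∀ k → X k ≈ Y k
byD-injective n {X} {Y} e = go
  where
  open ≈-Reasoning
  p = oneMinusQ (suc n)
  r = invOneMinusQ (suc n)
  q = qPow (suc n)
  isolate : ∀ p r q x u → (p * r * (p * r) * x) ≈ (r * r * ((p * p * x - q * u) + q * u))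
  isolate = solve 5 (λ p r q x u → p :* r :* (p :* r) :* x := r :* r :* ((p :* p :* x :- q :* u) :+ q :* u)) SR.refl
  unit : ∀ x → (p * r * (p * r) * x) ≈ x
  unit x = SR.trans (*ʳ x (SR.trans (SR.*-cong (inv-oneMinusQ n) (inv-oneMinusQ n)) (SR.*-identityˡ oneS))) (SR.*-identityˡ x)
  step : ∀ k → byY X k ≈ byY Y k → X k ≈ Y k
  step k eY = begin
    X k                                  ≈⟨ SR.sym (unit (X k)) ⟩
    (p * r * (p * r) * X k)              ≈⟨ isolate p r q (X k) (byY X k) ⟩
    (r * r * (byD (suc n) X k + q * byY X k))  ≈⟨ *ˡ (r * r) (SR.+-cong (e k) (*ˡ q eY)) ⟩
    (r * r * (byD (suc n) Y k + q * byY Y k))  ≈⟨ SR.sym (isolate p r q (Y k) (byY Y k)) ⟩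
    (p * r * (p * r) * Y k)              ≈⟨ unit (Y k) ⟩
    Y k                                  ∎
  go : ∀ k → X k ≈ Y k
  go zero    = step zero SR.refl
  go (suc k) = step (suc k) (go k)

-- Crank moments as coefficients of powers of y

crankMoments : ℕ → ℕ → Series
crankMoments j k = crankSum j j (momentWeight k)

crankMoments-suc : ∀ n k → byD (suc n) (crankMoments (suc n)) k ≈ crankMoments n k
-- The weight of order 0 is constantly 1, so its second difference is 0, in agreement with `byY` at
-- index 0.
crankMoments-suc n zero = SR.trans
  (-ˡ (oneMinusQ (suc n) * oneMinusQ (suc n) * crankMoments (suc n) 0) (*ˡ (qPow (suc n)) (SR.sym crankSum-0)))
  (crankSum-second-difference n {momentWeight 0} {λ _ → 0ℤ} (λ m → refl))
  where
  crankSum-0 : crankSum (suc n) (suc n) (λ _ → 0ℤ) ≈ zeroS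
  crankSum-0 = pointwise λ i → trans (conv-cong (λ i j → trans (∑-cong (partsLE (suc n) i) (λ _ → ∑-zero (partsLE (suc n) j))) (∑-zero (partsLE (suc n) i))) i) (conv-zero i)
crankMoments-suc n (suc k) = crankSum-second-difference n {momentWeight (suc k)} {momentWeight k} (momentWeight-second-difference k)

-- The constant 1 as a series in y, so that `byY unitSeq` is y itself.
unitSeq : ℕ → Series
unitSeq zero    = oneS
unitSeq (suc k) = zeroS

crankMoments-zero : ∀ k → crankMoments 0 k ≈ unitSeq k
crankMoments-zero zero    = SR.trans (crankSum-zero (momentWeight 0)) (SR.sym (embed-const 1ℤ))
crankMoments-zero (suc k) = SR.trans (crankSum-zero (momentWeight (suc k))) (SR.trans (SR.reflexive (cong const (momentWeight-at-zero k))) (SR.sym (embed-const 0ℤ)))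

-- The recursions in N

crankSide : ℕ → ℕ → Series
crankSide N k = signSum (decRange 1 N) * crankMoments N k

crankSide-suc : ∀ N k → byD (suc N) (crankSide (suc N)) k ≈ (oneMinusQ (suc N) * crankSide N k)
crankSide-suc N k = begin
  byD (suc N) (crankSide (suc N)) k
    ≈⟨ byD-* (suc N) (signSum (decRange 1 (suc N))) (crankMoments (suc N)) k ⟩
  (signSum (decRange 1 (suc N)) * byD (suc N) (crankMoments (suc N)) k)
    ≈⟨ SR.*-cong (signSum-decRange 0 (suc N)) (crankMoments-suc N k) ⟩
  (oneMinusQ (suc N) * pochFrom 0 N * crankMoments N k)
    ≈⟨ SR.*-assoc (oneMinusQ (suc N)) (pochFrom 0 N) (crankMoments N k) ⟩
  (oneMinusQ (suc N) * (pochFrom 0 N * crankMoments N k))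
    ≈⟨ *ˡ (oneMinusQ (suc N)) (*ʳ (crankMoments N k) (SR.sym (signSum-decRange 0 N))) ⟩
  (oneMinusQ (suc N) * crankSide N k) ∎
  where open ≈-Reasoning

sumTo : (ℕ → Series) → ℕ → Series
sumTo t J n = ∑ (upTo J) (λ j → t j n)

sumTo-suc : ∀ t J → sumTo t (suc J) ≈ (sumTo t J + t J)
sumTo-suc t J = pointwise λ n → trans (cong (λ js → ∑ js (λ j → t j n)) (sym (upTo-∷ʳ J)))
  (trans (∑-++ (upTo J) (J ∷ []) (λ j → t j n)) (cong (λ s → sumTo t J n ℤ.+ s) (ℤ.+-identityʳ (t J n))))

rankTerm : ℕ → ℕ → ℕ → Series
rankTerm N j k = signSum (decRange (suc N ∸ j) N) * rankSum j (momentWeight k)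

-- In the coordinates j + d = N the interval [N - j + 1, N] is [d + 1, d + j], free of truncated
-- subtraction.
rankTerm-formula : ∀ d j {N} k → j ℕ.+ d ≡ N → rankTerm N j k ≈ (pochFrom d j * qPow (j ℕ.* j) * crankMoments j k)
rankTerm-formula d j k refl = SR.trans
  (SR.*-cong (SR.trans (SR.reflexive (cong signSum interval)) (signSum-decRange d j)) (rankSum-crankSum j (momentWeight k)))
  (SR.sym (SR.*-assoc (pochFrom d j) (qPow (j ℕ.* j)) (crankMoments j k)))
  where
  interval : decRange (suc (j ℕ.+ d) ∸ j) (j ℕ.+ d) ≡ decRange (suc d) (d ℕ.+ j)
  interval = cong₂ decRange (trans (cong (_∸ j) (sym (ℕ.+-suc j d))) (ℕ.m+n∸m≡n j (suc d))) (ℕ.+-comm j d)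

-- The sum includes j = 0, which `NS1` omits. That term is the constant 1 in y, so it leaves moments
-- of positive order unchanged, and the telescoping starts from it.
rankSide : ℕ → ℕ → Series
rankSide N k = sumTo (λ j → rankTerm N j k) (suc N)

-- rankTerm N j with N = j + d telescopes through
-- U j d = q^d (1 − q^(d+1)) ⋯ (1 − q^N) q^(j²) · D_j κ_j, where κ_j are the crank moments.
U : ℕ → ℕ → ℕ → Series
U j d k = qPow d * (pochFrom d j * qPow (j ℕ.* j)) * byD j (crankMoments j) k

-- Both boundary terms come from the same κ_j: the first carries D_j κ_j, and the second a bare κ_j,
-- which is D_(j+1) κ_(j+1) by `crankMoments-suc`. What remains is a polynomial identity in x = q^j
-- and w = q^(d+1), where q^(N+1) = x w.
rankTerm-telescope : ∀ j d {N} k → j ℕ.+ d ≡ N →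
  byD (suc N) (rankTerm (suc N) j) k ≈ (oneMinusQ (suc N) * rankTerm N j k + (U j (suc d) k - U (suc j) d k))
rankTerm-telescope j d {N} k refl = begin
  byD (suc N) (rankTerm (suc N) j) k
    ≈⟨ byD-cong (suc N) (λ k → rankTerm-formula (suc d) j k (ℕ.+-suc j d)) k ⟩
  byD (suc N) (λ k → P * κ j k) k
    ≈⟨ byD-* (suc N) P (κ j) k ⟩
  (P * ((oneS - qPow (suc N)) * (oneS - qPow (suc N)) * κ j k - qPow (suc N) * byY (κ j) k))
    ≈⟨ *ˡ P (SR.+-cong (*ʳ (κ j k) (SR.*-cong (-ˡ oneS split) (-ˡ oneS split))) (SR.-‿cong (*ʳ (byY (κ j) k) split))) ⟩
  (P * ((oneS - x * w) * (oneS - x * w) * κ j k - x * w * byY (κ j) k))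
    ≈⟨ identity a s x w (κ j k) (byY (κ j) k) ⟩
  ((oneS - w) * a * s * κ j k + (w * (a * s) * ((oneS - x) * (oneS - x) * κ j k - x * byY (κ j) k) - (oneS - w) * a * (s * (x * x) * w) * κ j k))
    ≈⟨ SR.+-cong (first k) (-ˡ (U j (suc d) k) (second k)) ⟩
  (oneMinusQ (suc N) * rankTerm N j k + (U j (suc d) k - U (suc j) d k)) ∎
  where
  open ≈-Reasoning
  κ = crankMoments
  x = qPow j
  w = qPow (suc d)
  a = pochFrom (suc d) j
  s = qPow (j ℕ.* j)
  P = a * s
  split : qPow (suc N) ≈ (x * w)
  split = SR.sym (SR.trans (qPow-+ j (suc d)) (SR.reflexive (cong qPow (ℕ.+-suc j d))))
  identity : ∀ a s x w u v →
    (a * s * ((oneS - x * w) * (oneS - x * w) * u - x * w * v)) ≈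
    ((oneS - w) * a * s * u + (w * (a * s) * ((oneS - x) * (oneS - x) * u - x * v) - (oneS - w) * a * (s * (x * x) * w) * u))
  identity = solve 6 (λ a s x w u v →
    (a :* s :* ((con 1ℤ :- x :* w) :* (con 1ℤ :- x :* w) :* u :- x :* w :* v)) :=
    ((con 1ℤ :- w) :* a :* s :* u :+ (w :* (a :* s) :* ((con 1ℤ :- x) :* (con 1ℤ :- x) :* u :- x :* v) :- (con 1ℤ :- w) :* a :* (s :* (x :* x) :* w) :* u))) SR.refl
  -- Both products of 1 - q^i are `pochFrom d (suc j)`, with its first factor split off on one side
  -- and its last on the other.
  first : ∀ k → ((oneS - w) * a * s * κ j k) ≈ (oneMinusQ (suc N) * rankTerm N j k)
  first k = begin
    ((oneS - w) * a * s * κ j k)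
      ≈⟨ *ʳ (κ j k) (*ʳ s (SR.sym (pochFrom-first d j))) ⟩
    (oneMinusQ (suc d ℕ.+ j) * pochFrom d j * s * κ j k)
      ≈⟨ *ʳ (κ j k) (*ʳ s (*ʳ (pochFrom d j) (SR.reflexive (cong (λ i → oneMinusQ (suc i)) (ℕ.+-comm d j))))) ⟩
    (oneMinusQ (suc N) * pochFrom d j * s * κ j k)
      ≈⟨ reassoc (oneMinusQ (suc N)) (pochFrom d j) s (κ j k) ⟩
    (oneMinusQ (suc N) * (pochFrom d j * s * κ j k))
      ≈⟨ *ˡ (oneMinusQ (suc N)) (SR.sym (rankTerm-formula d j k refl)) ⟩
    (oneMinusQ (suc N) * rankTerm N j k) ∎
    where
    reassoc : ∀ a b c d → (a * b * c * d) ≈ (a * (b * c * d))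
    reassoc = solve 4 (λ a b c d → a :* b :* c :* d := a :* (b :* c :* d)) SR.refl
  -- Completing the square, j² + 2j + 1 = (j + 1)², turns the weight of the j-th Durfee square into
  -- the next one.
  exponents : ∀ j d → j ℕ.* j ℕ.+ (j ℕ.+ j) ℕ.+ suc d ≡ d ℕ.+ suc j ℕ.* suc j
  exponents = solveℕ-∀
  powers : (s * (x * x) * w) ≈ (qPow d * qPow (suc j ℕ.* suc j))
  powers = begin
    (s * (x * x) * w)                                    ≈⟨ *ʳ w (SR.trans (*ˡ s (qPow-+ j j)) (qPow-+ (j ℕ.* j) (j ℕ.+ j))) ⟩
    (qPow (j ℕ.* j ℕ.+ (j ℕ.+ j)) * w)                   ≈⟨ qPow-+ (j ℕ.* j ℕ.+ (j ℕ.+ j)) (suc d) ⟩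
    qPow (j ℕ.* j ℕ.+ (j ℕ.+ j) ℕ.+ suc d)               ≈⟨ SR.reflexive (cong qPow (exponents j d)) ⟩
    qPow (d ℕ.+ suc j ℕ.* suc j)                         ≈⟨ SR.sym (qPow-+ d (suc j ℕ.* suc j)) ⟩
    (qPow d * qPow (suc j ℕ.* suc j))                    ∎
  second : ∀ k → ((oneS - w) * a * (s * (x * x) * w) * κ j k) ≈ U (suc j) d k
  second k = begin
    ((oneS - w) * a * (s * (x * x) * w) * κ j k)
      ≈⟨ SR.*-cong (SR.*-cong (SR.sym (pochFrom-first d j)) powers) (SR.sym (crankMoments-suc j k)) ⟩
    (pochFrom d (suc j) * (qPow d * qPow (suc j ℕ.* suc j)) * byD (suc j) (κ (suc j)) k)
      ≈⟨ *ʳ (byD (suc j) (κ (suc j)) k) (exchange (pochFrom d (suc j)) (qPow d) (qPow (suc j ℕ.* suc j))) ⟩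
    U (suc j) d k ∎
    where
    exchange : ∀ a b c → (a * (b * c)) ≈ (b * (a * c))
    exchange = solve 3 (λ a b c → a :* (b :* c) := b :* (a :* c)) SR.refl

rankSide-partial : ∀ J d {N} k → J ℕ.+ d ≡ suc N →
  byD (suc N) (λ k → sumTo (λ j → rankTerm (suc N) j k) J) k
    ≈ (oneMinusQ (suc N) * sumTo (λ j → rankTerm N j k) J + (U 0 (suc N) k - U J d k))
rankSide-partial zero d {N} k refl = SR.trans (-ˡ (p * p * zeroS) (*ˡ (qPow (suc N)) (empty k)))
  (vanish p (qPow (suc N)) (U 0 (suc N) k))
  where
  p = oneMinusQ (suc N)
  empty : ∀ k → byY (λ k → sumTo (λ j → rankTerm (suc N) j k) 0) k ≈ zeroS
  empty zero    = SR.refl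
  empty (suc k) = SR.refl
  vanish : ∀ p q u → (p * p * zeroS - q * zeroS) ≈ (p * zeroS + (u - u))
  vanish = solve 3 (λ p q u → p :* p :* con 0ℤ :- q :* con 0ℤ := p :* con 0ℤ :+ (u :- u)) SR.refl
rankSide-partial (suc J) d {N} k e = begin
  byD (suc N) (λ k → sumTo (t′ k) (suc J)) k
    ≈⟨ byD-cong (suc N) (λ k → sumTo-suc (t′ k) J) k ⟩
  byD (suc N) (λ k → sumTo (t′ k) J + t′ k J) k
    ≈⟨ byD-+ (suc N) (λ k → sumTo (t′ k) J) (λ k → t′ k J) k ⟩
  (byD (suc N) (λ k → sumTo (t′ k) J) k + byD (suc N) (rankTerm (suc N) J) k)
    ≈⟨ SR.+-cong (rankSide-partial J (suc d) k (trans (ℕ.+-suc J d) e)) (rankTerm-telescope J d k (ℕ.suc-injective e)) ⟩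
  ((p * sumTo t J + (U 0 (suc N) k - U J (suc d) k)) + (p * t J + (U J (suc d) k - U (suc J) d k)))
    ≈⟨ collect p (sumTo t J) (U 0 (suc N) k) (U J (suc d) k) (t J) (U (suc J) d k) ⟩
  (p * (sumTo t J + t J) + (U 0 (suc N) k - U (suc J) d k))
    ≈⟨ +ʳ (U 0 (suc N) k - U (suc J) d k) (*ˡ p (SR.sym (sumTo-suc t J))) ⟩
  (p * sumTo t (suc J) + (U 0 (suc N) k - U (suc J) d k)) ∎
  where
  open ≈-Reasoning
  p = oneMinusQ (suc N)
  t′ : ℕ → ℕ → Series
  t′ k j = rankTerm (suc N) j k
  t : ℕ → Series
  t j = rankTerm N j k
  collect : ∀ p S u v t w → ((p * S + (u - v)) + (p * t + (v - w))) ≈ (p * (S + t) + (u - w))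
  collect = solve 6 (λ p S u v t w → (p :* S :+ (u :- v)) :+ (p :* t :+ (v :- w)) := p :* (S :+ t) :+ (u :- w)) SR.refl

-- The term j = N + 1 has no counterpart in `rankSide N`; it equals `U (suc N) 0` and cancels the
-- upper boundary of the telescoping sum. At the lower boundary D_0 = (1 - 1)² - y = -y, which
-- leaves -q^(N+1) y.
rankSide-suc : ∀ N k →
  byD (suc N) (rankSide (suc N)) k ≈ (oneMinusQ (suc N) * rankSide N k - qPow (suc N) * byY unitSeq k)
rankSide-suc N k = begin
  byD (suc N) (rankSide (suc N)) k
    ≈⟨ byD-cong (suc N) (λ k → sumTo-suc (λ j → rankTerm (suc N) j k) (suc N)) k ⟩
  byD (suc N) (λ k → sumTo (λ j → rankTerm (suc N) j k) (suc N) + rankTerm (suc N) (suc N) k) k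
    ≈⟨ byD-+ (suc N) (λ k → sumTo (λ j → rankTerm (suc N) j k) (suc N)) (rankTerm (suc N) (suc N)) k ⟩
  (byD (suc N) (λ k → sumTo (λ j → rankTerm (suc N) j k) (suc N)) k + byD (suc N) (rankTerm (suc N) (suc N)) k)
    ≈⟨ SR.+-cong (rankSide-partial (suc N) 0 k (ℕ.+-identityʳ (suc N))) last ⟩
  ((p * rankSide N k + (U 0 (suc N) k - U (suc N) 0 k)) + U (suc N) 0 k)
    ≈⟨ cancel (p * rankSide N k) (U 0 (suc N) k) (U (suc N) 0 k) ⟩
  (p * rankSide N k + U 0 (suc N) k)
    ≈⟨ +ˡ (p * rankSide N k) initial ⟩
  (p * rankSide N k - qPow (suc N) * byY unitSeq k) ∎
  where
  open ≈-Reasoning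
  p = oneMinusQ (suc N)
  P = pochFrom 0 (suc N) * qPow (suc N ℕ.* suc N)
  last : byD (suc N) (rankTerm (suc N) (suc N)) k ≈ U (suc N) 0 k
  last = SR.trans (byD-cong (suc N) (λ k → rankTerm-formula 0 (suc N) k (ℕ.+-identityʳ (suc N))) k)
    (SR.trans (byD-* (suc N) P (crankMoments (suc N)) k)
      (*ʳ (byD (suc N) (crankMoments (suc N)) k) (SR.sym (SR.trans (*ʳ P qPow-zero) (SR.*-identityˡ P)))))
  cancel : ∀ a u v → ((a + (u - v)) + v) ≈ (a + u)
  cancel = solve 3 (λ a u v → (a :+ (u :- v)) :+ v := a :+ u) SR.refl
  simplify : ∀ q u v → (q * (oneS * oneS) * ((oneS - oneS) * (oneS - oneS) * u - oneS * v)) ≈ SR.- (q * v)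
  simplify = solve 3 (λ q u v → q :* (con 1ℤ :* con 1ℤ) :* ((con 1ℤ :- con 1ℤ) :* (con 1ℤ :- con 1ℤ) :* u :- con 1ℤ :* v) := Solver.:- (q :* v)) SR.refl
  initial : U 0 (suc N) k ≈ (SR.- (qPow (suc N) * byY unitSeq k))
  initial = SR.trans (SR.*-cong (*ˡ (qPow (suc N)) (*ˡ oneS qPow-zero))
      (SR.+-cong (*ʳ (crankMoments 0 k) (SR.*-cong (-ˡ oneS qPow-zero) (-ˡ oneS qPow-zero)))
                 (SR.-‿cong (SR.*-cong qPow-zero (byY-cong crankMoments-zero k)))))
    (simplify (qPow (suc N)) (crankMoments 0 k) (byY unitSeq k))

-- The difference of crank and rank moments

difference : ℕ → ℕ → Series
difference N k = crankSide N k - rankSide N k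

difference-suc : ∀ N k →
  byD (suc N) (difference (suc N)) k ≈ (oneMinusQ (suc N) * difference N k + qPow (suc N) * byY unitSeq k)
difference-suc N k = begin
  byD (suc N) (difference (suc N)) k
    ≈⟨ byD-cong (suc N) (λ k → +ˡ (crankSide (suc N) k) (negate (rankSide (suc N) k))) k ⟩
  byD (suc N) (λ k → crankSide (suc N) k + (SR.- oneS) * rankSide (suc N) k) k
    ≈⟨ byD-+ (suc N) (crankSide (suc N)) (λ k → (SR.- oneS) * rankSide (suc N) k) k ⟩
  (byD (suc N) (crankSide (suc N)) k + byD (suc N) (λ k → (SR.- oneS) * rankSide (suc N) k) k)
    ≈⟨ SR.+-cong (crankSide-suc N k) (SR.trans (byD-* (suc N) (SR.- oneS) (rankSide (suc N)) k) (*ˡ (SR.- oneS) (rankSide-suc N k))) ⟩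
  (p * crankSide N k + (SR.- oneS) * (p * rankSide N k - qPow (suc N) * byY unitSeq k))
    ≈⟨ collect p (crankSide N k) (rankSide N k) (qPow (suc N) * byY unitSeq k) ⟩
  (p * (crankSide N k - rankSide N k) + qPow (suc N) * byY unitSeq k) ∎
  where
  open ≈-Reasoning
  p = oneMinusQ (suc N)
  negate : ∀ x → (SR.- x) ≈ ((SR.- oneS) * x)
  negate = solve 1 (λ x → Solver.:- x := (Solver.:- con 1ℤ) :* x) SR.refl
  collect : ∀ p c r u → (p * c + (SR.- oneS) * (p * r - u)) ≈ (p * (c - r) + u)
  collect = solve 4 (λ p c r u → p :* c :+ (Solver.:- con 1ℤ) :* (p :* r :- u) := p :* (c :- r) :+ u) SR.refl

rankTerm-zero : ∀ N k → rankTerm N 0 k ≈ unitSeq k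
rankTerm-zero N k = SR.trans (rankTerm-formula N 0 k refl) (SR.trans (SR.*-cong (*ˡ oneS qPow-zero) (crankMoments-zero k)) (unit (unitSeq k)))
  where
  unit : ∀ x → (oneS * oneS * x) ≈ x
  unit = solve 1 (λ x → con 1ℤ :* con 1ℤ :* x := x) SR.refl

difference-zero : ∀ k → difference 0 k ≈ zeroS
difference-zero k = SR.trans
  (SR.+-cong (SR.trans (SR.*-cong (signSum-decRange 0 0) (crankMoments-zero k)) (SR.*-identityˡ (unitSeq k)))
             (SR.-‿cong (SR.trans (pointwise λ n → ℤ.+-identityʳ (rankTerm 0 0 k n)) (rankTerm-zero 0 k))))
  (SR.-‿inverseʳ (unitSeq k))

difference-moments : ∀ N k n → difference N (suc k) n ≡ μ (suc k) N n ℤ.- η (suc k) N n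
difference-moments N k n = cong₂ ℤ._-_ (sym (μ-series (suc k) N n)) (begin
  ∑ (upTo (suc N)) (λ j → rankTerm N j (suc k) n)
    ≡⟨ ∑-upTo-suc (λ j → rankTerm N j (suc k) n) N ⟩
  rankTerm N 0 (suc k) n ℤ.+ ∑ (upTo N) (λ j → rankTerm N (suc j) (suc k) n)
    -- For positive order `unitSeq` vanishes, so the added term j = 0 drops out and the range of `η`
    -- is recovered.
    ≡⟨ cong₂ ℤ._+_ (at (rankTerm-zero N (suc k)) n) (sym (∑-map suc (upTo N) (λ j → rankTerm N j (suc k) n))) ⟩
  0ℤ ℤ.+ ∑ (range 1 N) (λ j → rankTerm N j (suc k) n)
    ≡⟨ ℤ.+-identityˡ _ ⟩
  ∑ (range 1 N) (λ j → rankTerm N j (suc k) n)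
    ≡⟨ sym (η-series (suc k) N n) ⟩
  η (suc k) N n ∎)
  where open ≡-Reasoning

-- The sum over chains

range-suc : ∀ {lo N} → lo ≤ suc N → range lo (suc N) ≡ range lo N ++ (suc N ∷ [])
range-suc {lo} {N} p = begin
  map (lo ℕ.+_) (upTo (suc (suc N) ∸ lo))              ≡⟨ cong (map (lo ℕ.+_) ∘ upTo) (ℕ.+-∸-assoc 1 p) ⟩
  map (lo ℕ.+_) (upTo (suc (suc N ∸ lo)))              ≡⟨ cong (map (lo ℕ.+_)) (sym (upTo-∷ʳ (suc N ∸ lo))) ⟩
  map (lo ℕ.+_) (upTo (suc N ∸ lo) ++ (suc N ∸ lo ∷ [])) ≡⟨ map-++ (lo ℕ.+_) (upTo (suc N ∸ lo)) (suc N ∸ lo ∷ []) ⟩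
  range lo N ++ (lo ℕ.+ (suc N ∸ lo) ∷ [])             ≡⟨ cong (λ x → range lo N ++ (x ∷ [])) (ℕ.m+[n∸m]≡n p) ⟩
  range lo N ++ (suc N ∷ [])                           ∎
  where open ≡-Reasoning

range-≤ : ∀ {lo N} → lo ≤ suc N → All (_≤ N) (range lo N)
range-≤ {lo} {N} p = All.map⁺ (All.tabulate λ {i} i∈ →
  ℕ.s≤s⁻¹ (subst (suc (lo ℕ.+ i) ≤_) (ℕ.m+[n∸m]≡n p) (subst (_≤ lo ℕ.+ (suc N ∸ lo)) (ℕ.+-suc lo i) (ℕ.+-monoʳ-≤ lo (∈-upTo⁻ i∈)))))

range-empty : ∀ N → range (suc N) N ≡ []
range-empty N = cong (map (suc N ℕ.+_) ∘ upTo) (ℕ.n∸n≡0 (suc N))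

∑S : List A → (A → Series) → Series
∑S xs f = sumS (map f xs)

∑S-cong : ∀ {xs : List A} {f g : A → Series} → All (λ x → f x ≈ g x) xs → ∑S xs f ≈ ∑S xs g
∑S-cong []       = SR.refl
∑S-cong (e ∷ es) = SR.+-cong e (∑S-cong es)

∑S-++ : ∀ (xs ys : List A) f → ∑S (xs ++ ys) f ≈ (∑S xs f + ∑S ys f)
∑S-++ []       ys f = SR.sym (SR.+-identityˡ (∑S ys f))
∑S-++ (x ∷ xs) ys f = SR.trans (+ˡ (f x) (∑S-++ xs ys f)) (SR.sym (SR.+-assoc (f x) (∑S xs f) (∑S ys f)))

∑S-snoc : ∀ (xs : List A) y f → ∑S (xs ++ (y ∷ [])) f ≈ (∑S xs f + f y)
∑S-snoc xs y f = SR.trans (∑S-++ xs (y ∷ []) f) (+ˡ (∑S xs f) (SR.+-identityʳ (f y)))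

∑S-* : ∀ (xs : List A) c f → ∑S xs (λ x → c * f x) ≈ (c * ∑S xs f)
∑S-* []       c f = SR.sym (SR.zeroʳ c)
∑S-* (x ∷ xs) c f = SR.trans (+ˡ (c * f x) (∑S-* xs c f)) (SR.sym (SR.distribˡ c (f x) (∑S xs f)))

∑S-+ : ∀ (xs : List A) f g → ∑S xs (λ x → f x + g x) ≈ (∑S xs f + ∑S xs g)
∑S-+ []       f g = SR.sym (SR.+-identityˡ zeroS)
∑S-+ (x ∷ xs) f g = SR.trans (+ˡ (f x + g x) (∑S-+ xs f g)) (interchange (f x) (g x) (∑S xs f) (∑S xs g))
  where
  interchange : ∀ a b c d → ((a + b) + (c + d)) ≈ ((a + c) + (b + d))
  interchange = solve 4 (λ a b c d → (a :+ b) :+ (c :+ d) := (a :+ c) :+ (b :+ d)) SR.refl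

∑S-concatMap-map : ∀ {C : Set} (φ : B → C → A) (ψ : B → List C) (xs : List B) f →
  ∑S (concatMap (λ x → map (φ x) (ψ x)) xs) f ≈ ∑S xs (λ x → ∑S (ψ x) (f ∘ φ x))
∑S-concatMap-map φ ψ []       f = SR.refl
∑S-concatMap-map φ ψ (x ∷ xs) f = SR.trans (∑S-++ (map (φ x) (ψ x)) (concatMap (λ x → map (φ x) (ψ x)) xs) f)
  (SR.+-cong (fuse (ψ x)) (∑S-concatMap-map φ ψ xs f))
  where
  fuse : ∀ ys → ∑S (map (φ x) ys) f ≈ ∑S ys (f ∘ φ x)
  fuse []       = SR.refl
  fuse (y ∷ ys) = +ˡ (f (φ x y)) (fuse ys)

factor : ℕ → Series
factor v = qPow v * (invOneMinusQ v * invOneMinusQ v)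

factors : List ℕ → Series
factors c = prodS (map factor c)

factors-split : ∀ c → (qPow (sum c) * prodS (map (λ v → invOneMinusQ v * invOneMinusQ v) c)) ≈ factors c
factors-split []      = SR.trans (*ʳ oneS qPow-zero) (SR.*-identityˡ oneS)
factors-split (v ∷ c) = begin
  (qPow (v ℕ.+ sum c) * (r * R))       ≈⟨ *ʳ (r * R) (SR.sym (qPow-+ v (sum c))) ⟩
  (qPow v * qPow (sum c) * (r * R))    ≈⟨ pair (qPow v) (qPow (sum c)) r R ⟩
  (qPow v * r * (qPow (sum c) * R))    ≈⟨ *ˡ (qPow v * r) (factors-split c) ⟩
  factors (v ∷ c)                      ∎
  where
  open ≈-Reasoning
  r = invOneMinusQ v * invOneMinusQ v
  R = prodS (map (λ v → invOneMinusQ v * invOneMinusQ v) c)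
  pair : ∀ a b c d → (a * b * (c * d)) ≈ (a * c * (b * d))
  pair = solve 4 (λ a b c d → a :* b :* (c :* d) := a :* c :* (b :* d)) SR.refl

-- The complete homogeneous symmetric polynomial of degree k in factor lo, …, factor N
homogeneous : ℕ → ℕ → ℕ → Series
homogeneous N zero    lo = oneS
homogeneous N (suc k) lo = ∑S (range lo N) (λ v → factor v * homogeneous N k v)

∑S-chains : ∀ N k lo → ∑S (chains N k lo) factors ≈ homogeneous N k lo
∑S-chains N zero    lo = SR.+-identityʳ oneS
∑S-chains N (suc k) lo = SR.trans (∑S-concatMap-map (λ v c → v ∷ c) (chains N k) (range lo N) factors)
  (∑S-cong (All.universal (λ v → SR.trans (∑S-* (chains N k v) (factor v) factors) (*ˡ (factor v) (∑S-chains N k v))) (range lo N)))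

-- Singles out the smallest index v, to which (q)_(n_1) is attached: `g = factor` gives the
-- homogeneous polynomial of the next degree, and `g v = poch v * factor v` the chain sum.
weighted : (ℕ → Series) → ℕ → ℕ → ℕ → Series
weighted g N k lo = ∑S (range lo N) (λ v → g v * homogeneous N k v)

weighted-first : ∀ g {N lo} → lo ≤ suc N → weighted g (suc N) 0 lo ≈ (weighted g N 0 lo + g (suc N))
weighted-first g {N} {lo} p = SR.trans (SR.reflexive (cong (λ r → ∑S r (λ v → g v * oneS)) (range-suc p)))
  (SR.trans (∑S-snoc (range lo N) (suc N) (λ v → g v * oneS)) (+ˡ (weighted g N 0 lo) (SR.*-identityʳ (g (suc N)))))

-- Monomials are sorted by whether the last variable occurs. The induction is mutual with
-- `weighted-suc`, of which the case `g = factor` is this recursion one degree higher. The bound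
-- admits lo = N + 1, where the shorter range is empty.
homogeneous-suc : ∀ k {N lo} → lo ≤ suc N →
  homogeneous (suc N) (suc k) lo ≈ (homogeneous N (suc k) lo + factor (suc N) * homogeneous (suc N) k lo)

weighted-suc : ∀ g k {N lo} → lo ≤ suc N →
  weighted g (suc N) (suc k) lo ≈ (weighted g N (suc k) lo + factor (suc N) * weighted g (suc N) k lo)

homogeneous-suc zero    {N} {lo} p = SR.trans (weighted-first factor p) (+ˡ (homogeneous N 1 lo) (SR.sym (SR.*-identityʳ (factor (suc N)))))
homogeneous-suc (suc k) p = weighted-suc factor k p

weighted-suc g k {N} {lo} p = begin
  ∑S (range lo M) (λ v → g v * homogeneous M (suc k) v)
    ≈⟨ ∑S-cong (All.map (λ {v} v≤M → SR.trans (*ˡ (g v) (homogeneous-suc k v≤M)) (distribute (g v) (h v) (factor M) (homogeneous M k v))) (range-≤ (ℕ.m≤n⇒m≤1+n p))) ⟩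
  ∑S (range lo M) (λ v → g v * h v + factor M * (g v * homogeneous M k v))
    ≈⟨ ∑S-+ (range lo M) (λ v → g v * h v) (λ v → factor M * (g v * homogeneous M k v)) ⟩
  (∑S (range lo M) (λ v → g v * h v) + ∑S (range lo M) (λ v → factor M * (g v * homogeneous M k v)))
    ≈⟨ SR.+-cong lower (∑S-* (range lo M) (factor M) (λ v → g v * homogeneous M k v)) ⟩
  (weighted g N (suc k) lo + factor M * weighted g M k lo) ∎
  where
  open ≈-Reasoning
  M = suc N
  h : ℕ → Series
  h v = homogeneous N (suc k) v
  distribute : ∀ a b c d → (a * (b + c * d)) ≈ (a * b + c * (a * d))
  distribute = solve 4 (λ a b c d → a :* (b :+ c :* d) := a :* b :+ c :* (a :* d)) SR.refl
  -- No index lies between N + 1 and N, so v = N + 1 adds nothing to the sum without the last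
  -- variable.
  h-M : h M ≈ zeroS
  h-M = SR.reflexive (cong (λ r → ∑S r (λ v → factor v * homogeneous N k v)) (range-empty N))
  lower : ∑S (range lo M) (λ v → g v * h v) ≈ weighted g N (suc k) lo
  lower = begin
    ∑S (range lo M) (λ v → g v * h v)             ≈⟨ SR.reflexive (cong (λ r → ∑S r (λ v → g v * h v)) (range-suc p)) ⟩
    ∑S (range lo N ++ (M ∷ [])) (λ v → g v * h v) ≈⟨ ∑S-snoc (range lo N) M (λ v → g v * h v) ⟩
    (weighted g N (suc k) lo + g M * h M)         ≈⟨ +ˡ (weighted g N (suc k) lo) (*ˡ (g M) h-M) ⟩
    (weighted g N (suc k) lo + g M * zeroS)       ≈⟨ drop (weighted g N (suc k) lo) (g M) ⟩
    weighted g N (suc k) lo                       ∎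
    where
    drop : ∀ a b → (a + b * zeroS) ≈ a
    drop = solve 2 (λ a b → a :+ b :* con 0ℤ := a) SR.refl

-- The chain sum and the recursion for the right-hand side

chainSum : ℕ → ℕ → Series
chainSum N k = ∑S (chains N k 1) summand

chainSum-weighted : ∀ N k → chainSum N (suc k) ≈ weighted (λ v → poch v * factor v) N k 1
chainSum-weighted N k = SR.trans (∑S-concatMap-map (λ v c → v ∷ c) (chains N k) (range 1 N) summand)
  (∑S-cong (All.universal (λ v → SR.trans (∑S-cong (All.universal (summand-∷ v) (chains N k v)))
    (SR.trans (∑S-* (chains N k v) (poch v * factor v) factors) (*ˡ (poch v * factor v) (∑S-chains N k v)))) (range 1 N)))
  where
  summand-∷ : ∀ v c → summand (v ∷ c) ≈ (poch v * factor v * factors c)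
  summand-∷ v c = SR.trans (*ˡ (poch v) (factors-split (v ∷ c))) (SR.sym (SR.*-assoc (poch v) (factor v) (factors c)))

chainSum-zero : ∀ N → chainSum N 0 ≈ zeroS
chainSum-zero N = SR.+-identityʳ zeroS

-- Chains are sorted by whether their largest entry is N + 1. Since `summand []` is 0, the chain
-- consisting of N + 1 alone cannot arise by extending the empty chain; `unitSeq` supplies it when k
-- = 0, with its weight (q)_(N+1).
chainSum-suc : ∀ N k →
  chainSum (suc N) (suc k) ≈ (chainSum N (suc k) + factor (suc N) * (chainSum (suc N) k + poch (suc N) * unitSeq k))
chainSum-suc N zero = begin
  chainSum M 1                                                          ≈⟨ chainSum-weighted M 0 ⟩
  weighted g M 0 1                                                      ≈⟨ weighted-first g {N} (s≤s z≤n) ⟩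
  (weighted g N 0 1 + g M)                                              ≈⟨ SR.+-cong (SR.sym (chainSum-weighted N 0)) (rearrange (poch M) (factor M)) ⟩
  (chainSum N 1 + factor M * (zeroS + poch M * oneS))                   ≈⟨ +ˡ (chainSum N 1) (*ˡ (factor M) (+ʳ (poch M * oneS) (SR.sym (chainSum-zero M)))) ⟩
  (chainSum N 1 + factor M * (chainSum M 0 + poch M * oneS))            ∎
  where
  open ≈-Reasoning
  M = suc N
  g : ℕ → Series
  g v = poch v * factor v
  rearrange : ∀ a b → (a * b) ≈ (b * (zeroS + a * oneS))
  rearrange = solve 2 (λ a b → a :* b := b :* (con 0ℤ :+ a :* con 1ℤ)) SR.refl
chainSum-suc N (suc k) = begin
  chainSum M (suc (suc k))
    ≈⟨ chainSum-weighted M (suc k) ⟩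
  weighted g M (suc k) 1
    ≈⟨ weighted-suc g k {N} (s≤s z≤n) ⟩
  (weighted g N (suc k) 1 + factor M * weighted g M k 1)
    ≈⟨ SR.+-cong (SR.sym (chainSum-weighted N (suc k))) (*ˡ (factor M) (SR.sym (chainSum-weighted M k))) ⟩
  (chainSum N (suc (suc k)) + factor M * chainSum M (suc k))
    ≈⟨ +ˡ (chainSum N (suc (suc k))) (*ˡ (factor M) (pad (chainSum M (suc k)) (poch M))) ⟩
  (chainSum N (suc (suc k)) + factor M * (chainSum M (suc k) + poch M * zeroS)) ∎
  where
  open ≈-Reasoning
  M = suc N
  g : ℕ → Series
  g v = poch v * factor v
  pad : ∀ a b → a ≈ (a + b * zeroS)
  pad = solve 2 (λ a b → a := a :+ b :* con 0ℤ) SR.refl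

prodS-range-suc : ∀ (f : ℕ → Series) N → prodS (map f (range 1 (suc N))) ≈ (prodS (map f (range 1 N)) * f (suc N))
prodS-range-suc f N = SR.trans (SR.reflexive (cong (prodS ∘ map f) (range-suc {1} {N} (s≤s z≤n)))) (snoc (range 1 N))
  where
  snoc : ∀ xs → prodS (map f (xs ++ (suc N ∷ []))) ≈ (prodS (map f xs) * f (suc N))
  snoc []       = SR.*-comm (f (suc N)) oneS
  snoc (x ∷ xs) = SR.trans (*ˡ (f x) (snoc xs)) (SR.sym (SR.*-assoc (f x) (prodS (map f xs)) (f (suc N))))

invPoch-poch : ∀ N → (invPoch N * poch N) ≈ oneS
invPoch-poch zero    = SR.*-identityˡ oneS
invPoch-poch (suc N) = begin
  (invPoch (suc N) * poch (suc N))    ≈⟨ SR.*-cong (prodS-range-suc invOneMinusQ N) (prodS-range-suc oneMinusQ N) ⟩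
  (invPoch N * r * (poch N * p))      ≈⟨ pair (invPoch N) r (poch N) p ⟩
  (invPoch N * poch N * (p * r))      ≈⟨ SR.*-cong (invPoch-poch N) (inv-oneMinusQ N) ⟩
  (oneS * oneS)                       ≈⟨ SR.*-identityˡ oneS ⟩
  oneS                                ∎
  where
  open ≈-Reasoning
  p = oneMinusQ (suc N)
  r = invOneMinusQ (suc N)
  pair : ∀ a b c d → (a * b * (c * d)) ≈ (a * c * (d * b))
  pair = solve 4 (λ a b c d → a :* b :* (c :* d) := a :* c :* (d :* b)) SR.refl

rhs-0 : ∀ N → rhs 0 N ≈ zeroS
rhs-0 N = SR.trans (*ˡ (invPoch N) (chainSum-zero N)) (SR.zeroʳ (invPoch N))

-- The factor (1 - q^M)² clears the denominator of `factor M`; the chain sum of length one less then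
-- cancels against the -q^M y part of D_M, and (q)_M / (q)_M = 1 leaves q^M y.
rhs-suc : ∀ N k →
  byD (suc N) (λ k → rhs k (suc N)) k ≈ (oneMinusQ (suc N) * rhs k N + qPow (suc N) * byY unitSeq k)
rhs-suc N zero = SR.trans (+ʳ (SR.- (qPow (suc N) * zeroS)) (*ˡ (p * p) (rhs-0 (suc N))))
  (SR.trans (vanish p (qPow (suc N))) (+ʳ (qPow (suc N) * zeroS) (*ˡ p (SR.sym (rhs-0 N)))))
  where
  p = oneMinusQ (suc N)
  vanish : ∀ p q → (p * p * zeroS - q * zeroS) ≈ (p * zeroS + q * zeroS)
  vanish = solve 2 (λ p q → p :* p :* con 0ℤ :- q :* con 0ℤ := p :* con 0ℤ :+ q :* con 0ℤ) SR.refl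
rhs-suc N (suc k) = begin
  (p * p * (invPoch M * chainSum M (suc k)) - q * (invPoch M * w))
    ≈⟨ SR.+-cong (*ˡ (p * p) (SR.*-cong (prodS-range-suc invOneMinusQ N) (chainSum-suc N k))) (SR.-‿cong (*ˡ q (*ʳ w (prodS-range-suc invOneMinusQ N)))) ⟩
  (p * p * (i * r * (v + q * (r * r) * (w + P * e))) - q * (i * r * w))
    ≈⟨ expand p r q i v w P e ⟩
  ((p * (i * v) + q * e) + ((p * r - oneS) * s + (i * r * P - oneS) * (q * e)))
    ≈⟨ +ˡ (p * (i * v) + q * e) (SR.+-cong (*ʳ s (-ʳ (inv-oneMinusQ N))) (*ʳ (q * e) (-ʳ (SR.trans (*ʳ P (SR.sym (prodS-range-suc invOneMinusQ N))) (invPoch-poch M))))) ⟩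
  ((p * (i * v) + q * e) + ((oneS - oneS) * s + (oneS - oneS) * (q * e)))
    ≈⟨ drop (p * (i * v) + q * e) s (q * e) ⟩
  (p * (i * v) + q * e) ∎
  where
  open ≈-Reasoning
  M = suc N
  p = oneMinusQ M
  r = invOneMinusQ M
  q = qPow M
  i = invPoch N
  v = chainSum N (suc k)
  w = chainSum M k
  P = poch M
  e = unitSeq k
  -- The cofactor of p r - 1. The relations p r = 1 and i r P = 1 lie outside the ring solver, so
  -- the discrepancy is written as an explicit combination of p r - 1 and i r P - 1; the factor p r
  -- + 1 comes from (p r)² - 1.
  s = p * (i * v) + (p * r + oneS) * (q * (i * r * w) + q * (i * r * P * e))
  -ʳ : ∀ {x y} → x ≈ y → (x - oneS) ≈ (y - oneS)
  -ʳ = +ʳ (SR.- oneS)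
  expand : ∀ p r q i v w P e →
    (p * p * (i * r * (v + q * (r * r) * (w + P * e))) - q * (i * r * w)) ≈
    ((p * (i * v) + q * e) + ((p * r - oneS) * (p * (i * v) + (p * r + oneS) * (q * (i * r * w) + q * (i * r * P * e))) + (i * r * P - oneS) * (q * e)))
  expand = solve 8 (λ p r q i v w P e →
    (p :* p :* (i :* r :* (v :+ q :* (r :* r) :* (w :+ P :* e))) :- q :* (i :* r :* w)) :=
    ((p :* (i :* v) :+ q :* e) :+ ((p :* r :- con 1ℤ) :* (p :* (i :* v) :+ (p :* r :+ con 1ℤ) :* (q :* (i :* r :* w) :+ q :* (i :* r :* P :* e))) :+ (i :* r :* P :- con 1ℤ) :* (q :* e)))) SR.refl
  drop : ∀ a b c → (a + ((oneS - oneS) * b + (oneS - oneS) * c)) ≈ a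
  drop = solve 3 (λ a b c → a :+ ((con 1ℤ :- con 1ℤ) :* b :+ (con 1ℤ :- con 1ℤ) :* c) := a) SR.refl

rhs-N0 : ∀ k → rhs k 0 ≈ zeroS
rhs-N0 zero    = rhs-0 0
rhs-N0 (suc k) = SR.zeroʳ (invPoch 0)

difference-rhs : ∀ N k → difference N k ≈ rhs k N
difference-rhs zero    k = SR.trans (difference-zero k) (SR.sym (rhs-N0 k))
difference-rhs (suc N) = byD-injective N λ k → SR.trans (difference-suc N k)
  (SR.trans (+ʳ (qPow (suc N) * byY unitSeq k) (*ˡ (oneMinusQ (suc N)) (difference-rhs N k))) (SR.sym (rhs-suc N k)))

lhs-difference : ∀ N k n → lhs (suc k) N n ≡ difference N (suc k) n
lhs-difference N k (suc n) = sym (difference-moments N k (suc n))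
-- At n = 0 only m = 0 is in range and its weight is 0, so both moments agree with the constant term
-- 0 prescribed by `lhs`.
lhs-difference N k zero    = sym (trans (difference-moments N k 0) (cong₂ ℤ._-_ (at-zero (MS2 N 0ℤ 0)) (at-zero (NS1 N 0ℤ 0))))
  where
  at-zero : ∀ x → momentWeight (suc k) 0ℤ ℤ.* x ℤ.+ 0ℤ ≡ 0ℤ
  at-zero x = trans (ℤ.+-identityʳ _) (cong (ℤ._* x) (momentWeight-at-zero k))

theorem2p5 : (N k : ℕ) → 1 ≤ N → 1 ≤ k → (n : ℕ) → lhs k N n ≡ rhs k N n
theorem2p5 N (suc k) _ _ n = trans (lhs-difference N k n) (at (difference-rhs N (suc k)) n)
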